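{- For every integer $k \geq 2$ there exist constants $A > 0$ and $t \in \mathbb{N}$, depending only on $k$, such that the following holds. Let $G = \mathbb{F}_2^n$ for some $n$, let $r$ be a non-negative integer, and let $\alpha \colon G^k \to \mathbb{F}_2$ be a multilinear form with $\operatorname{prank}(\alpha + \alpha \circ (1\,\,2)) \leq r$. Then there exists a multilinear form $\alpha' \colon G^k \to \mathbb{F}_2$ which is symmetric in the first $2$ variables and satisfies $\operatorname{prank}(\alpha + \alpha') \leq \exp^{(t)}(Ar)$.
   Context: For a permutation $\pi \in \operatorname{Sym}_k$ and a multilinear form $\alpha \colon G^k \to \mathbb{F}_2$, $\alpha\circ\pi$ is the multilinear form $(x_1,\dots,x_k) \mapsto \alpha(x_{\pi^{ -1}(1)}, \dots, x_{\pi^{ -1}(k)})$; in particular $\alpha \circ (1\,\,2)(x_1,x_2,x_3,\dots,x_k) = \alpha(x_2,x_1,x_3,\dots,x_k)$. A form is symmetric in a set of variables if it is invariant under all permutations of those variables. $\exp^{(t)}$ denotes the $t$-fold composition of the exponential function. The partition rank $\operatorname{prank}\alpha$ of a multilinear form $\alpha \colon G^k \to \mathbb{F}_2$ is the least non-negative integer $m$ such that \[\alpha(x_1,\dots,x_k) = \sum_{i=1}^m \beta_i(x_j : j \in I_i)\,\gamma_i(x_j : j \in [k]\setminus I_i)\] for some sets $\emptyset \neq I_i \subsetneq [k]$ and multilinear forms $\beta_i \colon G^{I_i} \to \mathbb{F}_2$, $\gamma_i \colon G^{[k]\setminus I_i} \to \mathbb{F}_2$. -}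

module Defs where

open import Level using (0ℓ)
open import Data.Fin using (Fin)
open import Data.Fin.Permutation
  using (Permutation′; _⟨$⟩ʳ_; _⟨$⟩ˡ_; inverseˡ; inverseʳ)
open import Data.Fin.Properties using (_≟_)
open import Data.Fin.Subset
  using (Subset; inside; outside; _∉_; _⊂_; ⊤; ∁; Nonempty; ∣_∣)
open import Data.Integer using (+_)
open import Data.Nat as ℕ using (ℕ)
import Data.Nat.GeneralisedArithmetic as ℕ
open import Data.Parity using (Parity)
  renaming (_+_ to _+ℙ_; _*_ to _*ℙ_)
import Data.Parity.Properties as ℙ
open import Data.Product using (Σ-syntax; ∃-syntax; _×_; _,_)
open import Data.Rational using (ℚ; 0ℚ; 1ℚ; _/_; _+_; _*_; _<_)
open import Data.Rational.Base using (+-*-rawSemiring)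
open import Algebra.Definitions.RawSemiring +-*-rawSemiring using (_^_)
open import Data.Vec using (Vec; []; _∷_; lookup; tabulate; zipWith; map; _[_]≔_)
open import Data.Vec.Properties
  using (lookup∘tabulate; tabulate∘lookup; tabulate-cong;
         lookup∘update; lookup∘update′)
open import Relation.Binary.PropositionalEquality
open import Relation.Nullary using (yes; no)
open import Relation.Unary using (Pred; _∈_)

open import Algebra.Properties.CommutativeSemigroup
  ℙ.+-commutativeSemigroup using (interchange)
open import Algebra.Properties.Monoid.Sum ℙ.+-0-monoid using (sum)

-- The field 𝔽₂ is Parity with its ring operations, so G n is 𝔽₂ⁿ.
G : ℕ → Set
G n = Vec Parity n

infixl 6 _+ᴳ_
infixl 7 _·ᴳ_

_+ᴳ_ : ∀ {n} → G n → G n → G n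
_+ᴳ_ = zipWith _+ℙ_

_·ᴳ_ : ∀ {n} → Parity → G n → G n
c ·ᴳ u = map (c *ℙ_) u

record MultilinearForm (n k : ℕ) : Set where
  field
    ⟦_⟧         : Vec (G n) k → Parity
    additive    : ∀ x i u v →
                  ⟦_⟧ (x [ i ]≔ (u +ᴳ v)) ≡ ⟦_⟧ (x [ i ]≔ u) +ℙ ⟦_⟧ (x [ i ]≔ v)
    homogeneous : ∀ x i c u →
                  ⟦_⟧ (x [ i ]≔ (c ·ᴳ u)) ≡ c *ℙ ⟦_⟧ (x [ i ]≔ u)

open MultilinearForm public

infixl 6 _⊕_

_⊕_ : ∀ {n k} → MultilinearForm n k → MultilinearForm n k → MultilinearForm n k
⟦ α ⊕ β ⟧ x = ⟦ α ⟧ x +ℙ ⟦ β ⟧ x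
additive (α ⊕ β) x i u v =
  trans (cong₂ _+ℙ_ (additive α x i u v) (additive β x i u v))
        (interchange (⟦ α ⟧ (x [ i ]≔ u)) (⟦ α ⟧ (x [ i ]≔ v))
                     (⟦ β ⟧ (x [ i ]≔ u)) (⟦ β ⟧ (x [ i ]≔ v)))
homogeneous (α ⊕ β) x i c u =
  trans (cong₂ _+ℙ_ (homogeneous α x i c u) (homogeneous β x i c u))
        (sym (ℙ.*-distribˡ-+ c (⟦ α ⟧ (x [ i ]≔ u)) (⟦ β ⟧ (x [ i ]≔ u))))

-- permute π (x₁ , … , xₖ) = (x_{π⁻¹(1)} , … , x_{π⁻¹(k)})
permute : ∀ {A : Set} {k} → Permutation′ k → Vec A k → Vec A k
permute π x = tabulate (λ j → lookup x (π ⟨$⟩ˡ j))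

permute-update : ∀ {A : Set} {k} (π : Permutation′ k) (x : Vec A k) i u →
                 permute π (x [ i ]≔ u) ≡ permute π x [ π ⟨$⟩ʳ i ]≔ u
permute-update π x i u =
  trans (tabulate-cong pointwise) (tabulate∘lookup (permute π x [ π ⟨$⟩ʳ i ]≔ u))
  where
  pointwise : ∀ j → lookup (x [ i ]≔ u) (π ⟨$⟩ˡ j)
                  ≡ lookup (permute π x [ π ⟨$⟩ʳ i ]≔ u) j
  pointwise j with j ≟ π ⟨$⟩ʳ i
  ... | yes refl =
    trans (cong (lookup (x [ i ]≔ u)) (inverseˡ π))
          (trans (lookup∘update i x u)
                 (sym (lookup∘update (π ⟨$⟩ʳ i) (permute π x) u)))
  ... | no j≢πi =
    trans (lookup∘update′ π⁻¹j≢i x u)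
          (sym (trans (lookup∘update′ j≢πi (permute π x) u)
                      (lookup∘tabulate _ j)))
    where
    π⁻¹j≢i : π ⟨$⟩ˡ j ≢ i
    π⁻¹j≢i eq = j≢πi (trans (sym (inverseʳ π)) (cong (π ⟨$⟩ʳ_) eq))

infixl 7 _∘ᶠ_

_∘ᶠ_ : ∀ {n k} → MultilinearForm n k → Permutation′ k → MultilinearForm n k
⟦ α ∘ᶠ π ⟧ x = ⟦ α ⟧ (permute π x)
additive (α ∘ᶠ π) x i u v
  rewrite permute-update π x i (u +ᴳ v)
        | permute-update π x i u
        | permute-update π x i v
  = additive α (permute π x) (π ⟨$⟩ʳ i) u v
homogeneous (α ∘ᶠ π) x i c u
  rewrite permute-update π x i (c ·ᴳ u)
        | permute-update π x i u
  = homogeneous α (permute π x) (π ⟨$⟩ʳ i) c u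

SymmetricIn : ∀ {n k} → Subset k → MultilinearForm n k → Set
SymmetricIn {k = k} S α =
  (π : Permutation′ k) → (∀ i → i ∉ S → π ⟨$⟩ʳ i ≡ i) →
  ⟦ α ∘ᶠ π ⟧ ≗ ⟦ α ⟧

-- (xⱼ : j ∈ I), listed in increasing order of j; this identifies the
-- power G^I with G^∣I∣.
infixl 8 _↾_

_↾_ : ∀ {A : Set} {k} → Vec A k → (I : Subset k) → Vec A ∣ I ∣
[]       ↾ []            = []
(x ∷ xs) ↾ (inside  ∷ I) = x ∷ xs ↾ I
(x ∷ xs) ↾ (outside ∷ I) = xs ↾ I

record SplitProduct (n k : ℕ) : Set where
  field
    I        : Subset k
    nonempty : Nonempty I
    proper   : I ⊂ ⊤
    β        : MultilinearForm n ∣ I ∣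
    γ        : MultilinearForm n ∣ ∁ I ∣

  value : Vec (G n) k → Parity
  value x = ⟦ β ⟧ (x ↾ I) *ℙ ⟦ γ ⟧ (x ↾ ∁ I)

HasDecomposition : ∀ {n k} → MultilinearForm n k → ℕ → Set
HasDecomposition {n} {k} α m =
  Σ[ s ∈ (Fin m → SplitProduct n k) ]
    (∀ x → ⟦ α ⟧ x ≡ sum (λ i → SplitProduct.value (s i) x))

-- IsPrank α m states prank α = m.
IsPrank : ∀ {n k} → MultilinearForm n k → ℕ → Set
IsPrank α m = HasDecomposition α m × (∀ m′ → HasDecomposition α m′ → m ℕ.≤ m′)

-- A real number x is represented by its lower Dedekind cut
-- { q ∈ ℚ | q < x }; the order x ≤ y is then inclusion of cuts.
LowerCut : Set₁
LowerCut = Pred ℚ 0ℓ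

cut : ℚ → LowerCut
cut x q = q < x

fromℕ : ℕ → ℚ
fromℕ m = + m / 1

-- Whenever N ≥ 1 and 1 + p/N > 0, (1 + p/N)^N ≤ exp p, with limit exp p as
-- N → ∞.  As exp is continuous and strictly increasing, exp x is therefore
-- the supremum, not attained, of (1 + p/N)^N over rational p < x and such N.
exp : LowerCut → LowerCut
exp x q = ∃[ p ] ∃[ N-1 ] let N = ℕ.suc N-1 ; b = 1ℚ + p * (+ 1 / N) in
  p ∈ x × 0ℚ < b × q < b ^ N

exp^ : ℕ → LowerCut → LowerCut
exp^ t x = ℕ.iterate exp x t

{-# OPTIONS --safe #-}
-- Put D α = α + α ∘ (1 2) and write D α as a sum of few products.  Replacing α
-- by α + τ with τ of small partition rank replaces D α by D α + D τ, and such
-- replacements are made until D α = 0.  Let z be the variables other than x and y.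
--
-- The sum T of all products splitting the variables as v | v′ can be written, by
-- interpolation, as T(v, v′) = ∑ⱼ wⱼ(v) T(pⱼ, v′) with as many points pⱼ as products,
-- and T(pⱼ, v′) is D α(pⱼ, v′) plus the other products at v = pⱼ.
--
-- Products h(x, y, z_M) g(z_{Mᶜ}) are removed with M maximal first: for v = z_{Mᶜ},
-- the term wⱼ D α(pⱼ, ·) is D of the product wⱼ α(pⱼ, ·), and the remaining
-- terms only produce intersections M ∩ M′.
--
-- Products f(x, z_X) g(y, z_Y) h(z_Z) are removed with X maximal first, where
-- subsets are ordered linearly by binary codes and, after adding products to α,
-- X > Y.  For v the variables other than x and z_X, the relation
-- D α(x, y, z) = D α(y, x, z) expresses T by products in which X has become a
-- proper subset.  When X = Y = ∅ throughout, D α = ∑ wⱼ(x) wₗ(y) dⱼₗ(z) with d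
-- symmetric and zero on the diagonal, which is D of its half with l < j.
module Submission where

open import Defs
open import Data.Nat using (ℕ; _≤_; _≥_)
open import Data.Fin using (inject≤)
open import Data.Fin.Patterns using (0F; 1F)
open import Data.Fin.Permutation using (transpose)
open import Data.Fin.Subset using (⁅_⁆; _∪_)
open import Data.Rational using (ℚ; 0ℚ; _<_; _*_)
open import Data.Product using (Σ-syntax; ∃-syntax; _×_)
open import Relation.Unary using (_⊆_)
open import Data.Bool using (Bool; true; false; if_then_else_; not; _∧_)
open import Data.Bool.Properties using (∧-zeroʳ; ∧-identityʳ; not-involutive)
open import Data.Fin using (Fin; zero; suc)
open import Data.Fin.Permutation using (Permutation′; _⟨$⟩ʳ_; _⟨$⟩ˡ_; inverseˡ; inverseʳ)
open import Data.Fin.Subset using (Subset; inside; outside; Nonempty; _⊂_; _∉_; ⊤; ∁; ∣_∣)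
open import Data.Fin.Subset.Properties
  using (anySubset?; nonempty?; _⊂?_; ∈⊤; ⊆⊤; x∈p∪q⁻; ∉⊥)
import Data.Integer as ℤ
import Data.Integer.Properties as ℤ
open import Data.Integer using (+_)
open import Data.List as List
  using (List; []; _∷_; _++_; allFin; concatMap; cartesianProductWith; length)
open import Data.List.Membership.Propositional using (_∈_; lose)
open import Data.List.Membership.Propositional.Properties
  using (∈-cartesianProductWith⁺; ∈-allFin)
open import Data.List.Properties using (map-tabulate; length-map; length-tabulate; length-++)
import Data.List.Relation.Unary.All as All
open import Data.List.Relation.Unary.Any as Any using (here; there)
open import Data.Nat as ℕ using (zero; suc; z≤n; s≤s)
open import Data.Nat.GeneralisedArithmetic using (iterate)
import Data.Nat.Properties as ℕ
open import Data.Nat.Tactic.RingSolver using (solve-∀)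
open import Data.Parity using (Parity; 0ℙ; 1ℙ)
  renaming (_+_ to infixl 6 _+ℙ_; _*_ to infixl 7 _*ℙ_)
import Data.Parity.Properties as ℙ
open import Data.Product using (Σ; ∃; _,_; proj₁; proj₂)
open import Data.Rational as ℚ using (1ℚ; _/_; toℚᵘ)
open import Data.Rational.Base using (+-*-rawSemiring)
import Data.Rational.Properties as ℚ
import Data.Rational.Unnormalised as ℚᵘ
import Data.Rational.Unnormalised.Properties as ℚᵘ
open import Data.Sum using (_⊎_; inj₁; inj₂; [_,_]′)
open import Data.Vec using (Vec; []; _∷_; _[_]≔_; head; here; there; lookup; replicate; tabulate)
open import Data.Vec.Properties
  using (≡-dec; lookup∘tabulate; tabulate∘lookup; tabulate-cong; lookup-map; []=⇒lookup; lookup⇒[]=)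
open import Function using (_∘_; id; _$_)
open import Relation.Binary.Definitions using (DecidableEquality)
open import Relation.Binary.PropositionalEquality
import Relation.Unary as U
open import Relation.Nullary using (Dec; yes; no; does; contradiction)
open import Relation.Nullary.Decidable using (map′; _×-dec_; from-yes; toWitness)
open import Algebra.Definitions.RawSemiring +-*-rawSemiring using (_^_)
open import Algebra.Properties.CommutativeSemigroup ℙ.+-commutativeSemigroup using (interchange)
open import Algebra.Properties.Monoid.Sum ℙ.+-0-monoid using (sum)
open import Algebra.Solver.Ring.AlmostCommutativeRing using (fromCommutativeRing)
open import Algebra.Solver.Ring.Simple
  (fromCommutativeRing ℙ.+-*-commutativeRing) ℙ._≟_
  using (solve; _:=_; _:+_; _:*_)

open ≡-Reasoning

-- Fixing variables `v` commutes with `D` when `v` contains neither `x` nor `y`. This divides the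
-- products into two kinds. For `h(x, y, z_M) g(z_Mᶜ)` the slices `α(pⱼ, ·)` are therefore
-- available, and changing `α` removes the products outright. For crossed products `v` contains `y`
-- but not `x`; slices of `α` say nothing about `D α` there, and only the symmetry of `D α` is left.
-- It trades the top products for others with `α` unchanged. Orienting them first makes this a
-- descent: exchanging `x` and `y` puts the smaller class `Y` in the place of `X`. Since `X` and `Y`
-- are disjoint, they tie only when both are empty, which is where the descent ends.
--
-- There characteristic 2 is the obstacle: a symmetric form need not be `τ + τ ∘ (1 2)`, as diagonal
-- terms `wⱼ(x) wⱼ(y) dⱼⱼ(z)` show. They vanish because `dⱼⱼ(z) = D α(p, p, z)` is twice a value of
-- `α`.
--
-- A step takes a bound `N` to `2N + 2N³`, and the number of steps depends on `k` alone, so the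
-- final bound is polynomial in `r`; two exponentials dominate each step.

private
  variable
    A B : Set
    n k m N : ℕ

-- Sums over 𝔽₂ and interpolation

∑ : List A → (A → Parity) → Parity
∑ []       f = 0ℙ
∑ (x ∷ xs) f = f x +ℙ ∑ xs f

∑ᶠ : (Fin m → Parity) → Parity
∑ᶠ = ∑ (allFin _)

∑-cong : ∀ (xs : List A) {f g : A → Parity} → (∀ x → f x ≡ g x) → ∑ xs f ≡ ∑ xs g
∑-cong []       eq = refl
∑-cong (x ∷ xs) eq = cong₂ _+ℙ_ (eq x) (∑-cong xs eq)

∑-zero : ∀ (xs : List A) {f : A → Parity} → (∀ x → f x ≡ 0ℙ) → ∑ xs f ≡ 0ℙ
∑-zero []       eq = refl
∑-zero (x ∷ xs) eq = cong₂ _+ℙ_ (eq x) (∑-zero xs eq)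

∑-+ : ∀ (xs : List A) (f g : A → Parity) →
      ∑ xs (λ x → f x +ℙ g x) ≡ ∑ xs f +ℙ ∑ xs g
∑-+ []       f g = refl
∑-+ (x ∷ xs) f g = trans (cong (f x +ℙ g x +ℙ_) (∑-+ xs f g)) (interchange (f x) (g x) (∑ xs f) (∑ xs g))

∑-*ˡ : ∀ (xs : List A) a (f : A → Parity) → ∑ xs (λ x → a *ℙ f x) ≡ a *ℙ ∑ xs f
∑-*ˡ []       a f = sym (ℙ.*-zeroʳ a)
∑-*ˡ (x ∷ xs) a f = trans (cong (a *ℙ f x +ℙ_) (∑-*ˡ xs a f))
                          (sym (ℙ.*-distribˡ-+ a (f x) (∑ xs f)))

∑-*ʳ : ∀ (xs : List A) (f : A → Parity) a → ∑ xs (λ x → f x *ℙ a) ≡ ∑ xs f *ℙ a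
∑-*ʳ xs f a = trans (∑-cong xs (λ x → ℙ.*-comm (f x) a))
                    (trans (∑-*ˡ xs a f) (ℙ.*-comm a (∑ xs f)))

∑-swap : ∀ (xs : List A) (ys : List B) (f : A → B → Parity) →
         ∑ xs (λ x → ∑ ys (f x)) ≡ ∑ ys (λ y → ∑ xs (λ x → f x y))
∑-swap []       ys f = sym (∑-zero ys (λ _ → refl))
∑-swap (x ∷ xs) ys f = trans (cong (∑ ys (f x) +ℙ_) (∑-swap xs ys f))
                             (sym (∑-+ ys (f x) (λ y → ∑ xs (λ x → f x y))))

∑-++ : ∀ (xs ys : List A) (f : A → Parity) → ∑ (xs ++ ys) f ≡ ∑ xs f +ℙ ∑ ys f
∑-++ []       ys f = refl
∑-++ (x ∷ xs) ys f = trans (cong (f x +ℙ_) (∑-++ xs ys f))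
                           (sym (ℙ.+-assoc (f x) (∑ xs f) (∑ ys f)))

∑-map : ∀ (g : A → B) xs (f : B → Parity) → ∑ (List.map g xs) f ≡ ∑ xs (f ∘ g)
∑-map g []       f = refl
∑-map g (x ∷ xs) f = cong (f (g x) +ℙ_) (∑-map g xs f)

∑-concatMap : ∀ (g : A → List B) xs (f : B → Parity) →
              ∑ (concatMap g xs) f ≡ ∑ xs (λ x → ∑ (g x) f)
∑-concatMap g []       f = refl
∑-concatMap g (x ∷ xs) f = trans (∑-++ (g x) (concatMap g xs) f)
                                 (cong (∑ (g x) f +ℙ_) (∑-concatMap g xs f))

∑ᶠ-suc : (f : Fin (suc m) → Parity) → ∑ᶠ f ≡ f zero +ℙ ∑ᶠ (f ∘ suc)
∑ᶠ-suc f = cong (f zero +ℙ_)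
  (trans (cong (λ xs → ∑ xs f) (sym (map-tabulate id suc))) (∑-map suc (allFin _) f))

∑ᶠ-lookup : ∀ (xs : List A) (f : A → Parity) → ∑ᶠ (f ∘ List.lookup xs) ≡ ∑ xs f
∑ᶠ-lookup []       f = refl
∑ᶠ-lookup (x ∷ xs) f = trans (∑ᶠ-suc (f ∘ List.lookup (x ∷ xs)))
                             (cong (f x +ℙ_) (∑ᶠ-lookup xs f))

sum≡∑ᶠ : (f : Fin m → Parity) → sum f ≡ ∑ᶠ f
sum≡∑ᶠ {zero}  f = refl
sum≡∑ᶠ {suc m} f = trans (cong (f zero +ℙ_) (sum≡∑ᶠ (f ∘ suc))) (sym (∑ᶠ-suc f))

record Span (u : Fin m → A → Parity) (w : A → Parity) : Set where
  constructor span
  field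
    coeff   : Fin m → Parity
    expands : ∀ x → w x ≡ ∑ᶠ (λ l → coeff l *ℙ u l x)

module _ {u : Fin m → A → Parity} where

  span-0 : Span u (λ _ → 0ℙ)
  span-0 = span (λ _ → 0ℙ) $ λ x → sym (∑-zero (allFin m) (λ _ → refl))

  span-+ : ∀ {v w} → Span u v → Span u w → Span u (λ x → v x +ℙ w x)
  span-+ (span c v≡) (span d w≡) = span (λ l → c l +ℙ d l) $ λ x →
    trans (cong₂ _+ℙ_ (v≡ x) (w≡ x))
      (trans (sym (∑-+ (allFin m) _ _))
             (∑-cong (allFin m) (λ l → sym (ℙ.*-distribʳ-+ (u l x) (c l) (d l)))))

  span-* : ∀ a {w} → Span u w → Span u (λ x → a *ℙ w x)
  span-* a (span c w≡) = span (λ l → a *ℙ c l) $ λ x →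
    trans (cong (a *ℙ_) (w≡ x))
      (trans (sym (∑-*ˡ (allFin m) a _))
             (∑-cong (allFin m) (λ l → sym (ℙ.*-assoc a (c l) (u l x)))))

  span-∑ : ∀ (ys : List B) {w : B → A → Parity} → (∀ y → Span u (w y)) →
           Span u (λ x → ∑ ys (λ y → w y x))
  span-∑ []       sp = span-0
  span-∑ (y ∷ ys) sp = span-+ (sp y) (span-∑ ys sp)

  span-resp : ∀ {v w} → (∀ x → v x ≡ w x) → Span u w → Span u v
  span-resp eq (span c w≡) = span c $ λ x → trans (eq x) (w≡ x)

span-trans : {u : Fin m → A → Parity} {v : Fin N → A → Parity} → (∀ l → Span u (v l)) →
             ∀ {w} → Span v w → Span u w
span-trans sp (span c w≡) = span-resp w≡ (span-∑ (allFin _) (λ l → span-* (c l) (sp l)))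

∑ᶠ-δ : (i : Fin m) → Σ[ δ ∈ (Fin m → Parity) ] (∀ (f : Fin m → Parity) → ∑ᶠ (λ l → δ l *ℙ f l) ≡ f i)
∑ᶠ-δ {suc m} zero = δ , λ f → trans (∑ᶠ-suc (λ l → δ l *ℙ f l))
    (trans (cong (f zero +ℙ_) (∑-zero (allFin m) (λ _ → refl))) (ℙ.+-identityʳ (f zero)))
  where
  δ : Fin (suc m) → Parity
  δ zero    = 1ℙ
  δ (suc _) = 0ℙ
∑ᶠ-δ {suc m} (suc i) = δ , λ f →
    trans (∑ᶠ-suc (λ l → δ l *ℙ f l)) (proj₂ (∑ᶠ-δ i) (f ∘ suc))
  where
  δ : Fin (suc m) → Parity
  δ zero    = 0ℙ
  δ (suc l) = proj₁ (∑ᶠ-δ i) l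

span-gen : {u : Fin m → A → Parity} → ∀ i → Span u (u i)
span-gen {u = u} i = span (proj₁ (∑ᶠ-δ i)) $ λ x → sym (proj₂ (∑ᶠ-δ i) (λ l → u l x))

-- Gaussian elimination, with pivots chosen among the points of A.
interpolate : ((φ : A → Parity) → (∃[ x ] φ x ≡ 1ℙ) ⊎ (∀ x → φ x ≡ 0ℙ)) → A →
  (u : Fin m → A → Parity) →
  Σ[ p ∈ (Fin m → A) ] Σ[ w ∈ (Fin m → A → Parity) ]
    ((∀ j → Span u (w j)) × (∀ i x → u i x ≡ ∑ᶠ (λ j → u i (p j) *ℙ w j x)))
interpolate {m = zero} find a u = (λ ()) , (λ ()) , (λ ()) , λ ()
interpolate {A = A} {m = suc m} find a u with find (u zero)
... | inj₂ u₀≡0 with interpolate find a (u ∘ suc)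
... | p , w , sp , eq = p′ , w′ , sp′ , eq′
  where
  -- A vanishing function needs no point; the dummy point `a` with weight 0 keeps the number of
  -- points equal to the number of functions.
  p′ : Fin (suc m) → A
  p′ zero    = a
  p′ (suc j) = p j
  w′ : Fin (suc m) → A → Parity
  w′ zero    x = 0ℙ
  w′ (suc j) x = w j x
  sp′ : ∀ j → Span u (w′ j)
  sp′ zero    = span-0
  sp′ (suc j) = span-trans (λ l → span-gen (suc l)) (sp j)
  eq′ : ∀ i x → u i x ≡ ∑ᶠ (λ j → u i (p′ j) *ℙ w′ j x)
  eq′ zero    x = trans (u₀≡0 x)
    (sym (∑-zero (allFin (suc m)) (λ j → cong (_*ℙ w′ j x) (u₀≡0 (p′ j)))))
  eq′ (suc i) x = trans (eq i x)
    (sym (trans (∑ᶠ-suc (λ j → u (suc i) (p′ j) *ℙ w′ j x))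
                (cong (_+ℙ ∑ᶠ (λ j → u (suc i) (p j) *ℙ w j x)) (ℙ.*-zeroʳ (u (suc i) a)))))
interpolate {A = A} {m = suc m} find a u | inj₁ (q , u₀q≡1)
  -- As `u zero q` is 1, the functions passed on all vanish at the pivot `q`.
  with interpolate find a (λ i x → u (suc i) x +ℙ u (suc i) q *ℙ u zero x)
... | p , w , sp , eq = p′ , w′ , sp′ , eq′
  where
  w₀ : A → Parity
  w₀ x = ∑ᶠ (λ j → u zero (p j) *ℙ w j x)
  p′ : Fin (suc m) → A
  p′ zero    = q
  p′ (suc j) = p j
  -- The expansion of `u zero` must be `w′ zero` plus its values at the later points times their
  -- weights; the latter sum is `w₀`, so `w′ zero` has to be `u zero` minus `w₀`.
  w′ : Fin (suc m) → A → Parity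
  w′ zero    x = u zero x +ℙ w₀ x
  w′ (suc j) x = w j x
  spʷ : ∀ j → Span u (w j)
  spʷ j = span-trans (λ l → span-+ (span-gen (suc l)) (span-* (u (suc l) q) (span-gen zero))) (sp j)
  sp′ : ∀ j → Span u (w′ j)
  sp′ zero    = span-+ (span-gen zero) (span-∑ (allFin m) (λ j → span-* (u zero (p j)) (spʷ j)))
  sp′ (suc j) = spʷ j
  eq′ : ∀ i x → u i x ≡ ∑ᶠ (λ j → u i (p′ j) *ℙ w′ j x)
  eq′ zero    x = sym (trans (∑ᶠ-suc (λ j → u zero (p′ j) *ℙ w′ j x))
    (trans (cong (λ b → b *ℙ (u zero x +ℙ w₀ x) +ℙ w₀ x) u₀q≡1)
           (solve 2 (λ a b → a :+ b :+ b := a) refl (u zero x) (w₀ x))))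
  eq′ (suc i) x = begin
    u₁ x
      ≡⟨ solve 2 (λ a b → a := a :+ b :+ b) refl (u₁ x) (u₁ q *ℙ u zero x) ⟩
    u₁ x +ℙ u₁ q *ℙ u zero x +ℙ u₁ q *ℙ u zero x
      ≡⟨ cong (_+ℙ u₁ q *ℙ u zero x) (eq i x) ⟩
    ∑ᶠ (λ j → (u₁ (p j) +ℙ u₁ q *ℙ u zero (p j)) *ℙ w j x) +ℙ u₁ q *ℙ u zero x
      ≡⟨ cong (_+ℙ u₁ q *ℙ u zero x) (trans (∑-cong (allFin m) (λ j →
           solve 4 (λ a b c d → (a :+ b :* c) :* d := a :* d :+ b :* (c :* d)) refl
             (u₁ (p j)) (u₁ q) (u zero (p j)) (w j x)))
           (trans (∑-+ (allFin m) _ _)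
                  (cong (∑ᶠ (λ j → u₁ (p j) *ℙ w j x) +ℙ_) (∑-*ˡ (allFin m) (u₁ q) _)))) ⟩
    ∑ᶠ (λ j → u₁ (p j) *ℙ w j x) +ℙ u₁ q *ℙ w₀ x +ℙ u₁ q *ℙ u zero x
      ≡⟨ solve 4 (λ a b c d → a :+ b :* c :+ b :* d := b :* (d :+ c) :+ a) refl
           (∑ᶠ (λ j → u₁ (p j) *ℙ w j x)) (u₁ q) (w₀ x) (u zero x) ⟩
    u₁ q *ℙ (u zero x +ℙ w₀ x) +ℙ ∑ᶠ (λ j → u₁ (p j) *ℙ w j x)
      ≡⟨ sym (∑ᶠ-suc (λ j → u₁ (p′ j) *ℙ w′ j x)) ⟩
    ∑ᶠ (λ j → u₁ (p′ j) *ℙ w′ j x) ∎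
    where u₁ = u (suc i)

-- Finite search

Listing : Set → Set
Listing A = Σ[ xs ∈ List A ] (∀ x → x ∈ xs)

parities : Listing Parity
parities = 0ℙ ∷ 1ℙ ∷ [] , λ { 0ℙ → here refl ; 1ℙ → there (here refl) }

vectors : Listing A → ∀ n → Listing (Vec A n)
vectors (xs , _) zero = [] ∷ [] , λ { [] → here refl }
vectors (xs , x∈) (suc n) = cartesianProductWith _∷_ xs (proj₁ (vectors (xs , x∈) n)) ,
  λ { (x ∷ v) → ∈-cartesianProductWith⁺ _∷_ (x∈ x) (proj₂ (vectors (xs , x∈) n) v) }

∃? : Listing A → {P : A → Set} → (∀ x → Dec (P x)) → Dec (∃ P)
∃? (xs , x∈) P? = map′ Any.satisfied (λ (x , px) → lose (x∈ x) px) (Any.any? P? xs)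

∀? : Listing A → {P : A → Set} → (∀ x → Dec (P x)) → Dec (∀ x → P x)
∀? (xs , x∈) P? = map′ (λ ps x → All.lookup ps (x∈ x)) (λ ps → All.tabulate (λ {x} _ → ps x))
                       (All.all? P? xs)

points : ∀ n k → Listing (Vec (G n) k)
points n k = vectors (vectors parities n) k

_≟ⱽ_ : DecidableEquality (Vec (G n) k)
_≟ⱽ_ = ≡-dec (≡-dec ℙ._≟_)

find-nonzero : (φ : Vec (G n) k → Parity) → (∃[ x ] φ x ≡ 1ℙ) ⊎ (∀ x → φ x ≡ 0ℙ)
find-nonzero φ with ∃? (points _ _) (λ x → φ x ℙ.≟ 1ℙ)
... | yes ∃x = inj₁ ∃x
... | no ∄x = inj₂ zeros
  where
  zeros : ∀ x → φ x ≡ 0ℙ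
  zeros x with φ x in eq
  ... | 0ℙ = refl
  ... | 1ℙ = contradiction (x , eq) ∄x

tables : DecidableEquality A → List A → List (A → Parity)
tables _≟_ []       = (λ _ → 0ℙ) ∷ []
tables _≟_ (x ∷ xs) = cartesianProductWith (λ b f y → if does (y ≟ x) then b else f y)
                        (proj₁ parities) (tables _≟_ xs)

-- A listed function can match `g` only pointwise, not propositionally; this is why every search
-- below asks its predicate to respect pointwise equality.
tables-complete : (_≟_ : DecidableEquality A) (xs : List A) (g : A → Parity) →
                  ∃[ f ] (f ∈ tables _≟_ xs × (∀ {y} → y ∈ xs → f y ≡ g y))
tables-complete _≟_ []       g = _ , here refl , λ ()
tables-complete _≟_ (x ∷ xs) g with tables-complete _≟_ xs g
... | f , f∈ , f≡g = _ , ∈-cartesianProductWith⁺ (λ b f y → if does (y ≟ x) then b else f y) (proj₂ parities (g x)) f∈ , agree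
  where
  agree : ∀ {y} → y ∈ x ∷ xs → (if does (y ≟ x) then g x else f y) ≡ g y
  agree {y} y∈ with y ≟ x | y∈
  ... | yes refl | _         = refl
  ... | no  y≢x  | here y≡x  = contradiction y≡x y≢x
  ... | no  _    | there y∈′ = f≡g y∈′

∃-function? : Listing A → DecidableEquality A → {P : (A → Parity) → Set} →
              (∀ {f g} → f ≗ g → P f → P g) → (∀ f → Dec (P f)) → Dec (∃ P)
∃-function? (xs , x∈) _≟_ resp P? = map′ Any.satisfied
  (λ (g , pg) → let f , f∈ , f≡g = tables-complete _≟_ xs g in
                lose f∈ (resp (λ y → sym (f≡g (x∈ y))) pg))
  (Any.any? P? (tables _≟_ xs))

least : {P : ℕ → Set} → (∀ m → Dec (P m)) → P N →
        ∃[ m ] (P m × (∀ m′ → P m′ → m ≤ m′))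
least {N} P? pN with P? 0
... | yes p0 = 0 , p0 , λ _ _ → z≤n
least {zero}  P? pN | no ¬p0 = contradiction pN ¬p0
least {suc N} P? pN | no ¬p0 with least {N} (λ m → P? (suc m)) pN
... | m , pm , min = suc m , pm , λ { zero p0 → contradiction p0 ¬p0 ; (suc m′) pm′ → s≤s (min m′ pm′) }

-- Multilinearity in a set of variables

-- A form in a subset of the variables is kept as a function of all `k` variables, linear in those
-- of the subset and independent of the others. Factors over different subsets can then be
-- multiplied and substituted into without reindexing.
data At (φ : Vec (G n) k → Parity) (i : Fin k) : Bool → Set where
  linear   : (∀ x u v → φ (x [ i ]≔ (u +ᴳ v)) ≡ φ (x [ i ]≔ u) +ℙ φ (x [ i ]≔ v)) → At φ i true
  constant : (∀ x u → φ (x [ i ]≔ u) ≡ φ x) → At φ i false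

Multilinear : (Fin k → Bool) → (Vec (G n) k → Parity) → Set
Multilinear S φ = ∀ i → At φ i (S i)

everywhere : Fin k → Bool
everywhere _ = true

private
  variable
    S S′ : Fin k → Bool
    φ ψ : Vec (G n) k → Parity
    i : Fin k
    b b′ d : Bool

at-cong : φ ≗ ψ → At φ i b → At ψ i b
at-cong {i = i} eq (linear l)   = linear λ x u v →
  trans (sym (eq (x [ i ]≔ (u +ᴳ v)))) (trans (l x u v) (cong₂ _+ℙ_ (eq _) (eq _)))
at-cong {i = i} eq (constant c) = constant λ x u →
  trans (sym (eq (x [ i ]≔ u))) (trans (c x u) (eq x))

multilinear-cong : (∀ i → S i ≡ S′ i) → Multilinear S φ → Multilinear S′ φ
multilinear-cong eq ml i = subst (At _ i) (eq i) (ml i)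

at-0 : ∀ b → At {n} {k} (λ _ → 0ℙ) i b
at-0 true  = linear λ _ _ _ → refl
at-0 false = constant λ _ _ → refl

at-+ : At φ i b → At ψ i b → At (λ x → φ x +ℙ ψ x) i b
at-+ {φ = φ} {i = i} {ψ = ψ} (linear l) (linear l′) = linear λ x u v →
  trans (cong₂ _+ℙ_ (l x u v) (l′ x u v))
        (interchange (φ (x [ i ]≔ u)) (φ (x [ i ]≔ v)) (ψ (x [ i ]≔ u)) (ψ (x [ i ]≔ v)))
at-+ (constant c) (constant c′) = constant λ x u → cong₂ _+ℙ_ (c x u) (c′ x u)

at-*ˡ : ∀ a → At φ i b → At (λ x → a *ℙ φ x) i b
at-*ˡ a (linear l)   = linear λ x u v → trans (cong (a *ℙ_) (l x u v)) (ℙ.*-distribˡ-+ a _ _)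
at-*ˡ a (constant c) = constant λ x u → cong (a *ℙ_) (c x u)

at-∑ : (ys : List A) {φ : A → Vec (G n) k → Parity} → (∀ y → At (φ y) i b) →
       At (λ x → ∑ ys (λ y → φ y x)) i b
at-∑ []       at = at-0 _
at-∑ (y ∷ ys) at = at-+ (at y) (at-∑ ys at)

multilinear-span : {u : Fin m → Vec (G n) k → Parity} → (∀ l → Multilinear S (u l)) →
                   Span u φ → Multilinear S φ
multilinear-span mls (span c eq) i =
  at-cong (λ x → sym (eq x)) (at-∑ (allFin _) (λ l → at-*ˡ (c l) (mls l i)))

-- The graph of disjunction on pairs that are not both true: a product is multilinear in the union
-- of the supports of its factors provided that they share no variable.
data Disjoint : Bool → Bool → Bool → Set where
  neither : Disjoint false false false
  left    : Disjoint true  false true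
  right   : Disjoint false true  true

at-*-constant : At φ i b → At ψ i false → At (λ x → φ x *ℙ ψ x) i b
at-*-constant (constant c) (constant c′) = constant λ x u → cong₂ _*ℙ_ (c x u) (c′ x u)
at-*-constant {φ = φ} {i = i} {ψ = ψ} (linear l) (constant c) = linear λ x u v → begin
  φ (x [ i ]≔ (u +ᴳ v)) *ℙ ψ (x [ i ]≔ (u +ᴳ v))
    ≡⟨ cong₂ _*ℙ_ (l x u v) (c x (u +ᴳ v)) ⟩
  (φ (x [ i ]≔ u) +ℙ φ (x [ i ]≔ v)) *ℙ ψ x
    ≡⟨ ℙ.*-distribʳ-+ (ψ x) (φ (x [ i ]≔ u)) (φ (x [ i ]≔ v)) ⟩
  φ (x [ i ]≔ u) *ℙ ψ x +ℙ φ (x [ i ]≔ v) *ℙ ψ x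
    ≡⟨ sym (cong₂ (λ a b → φ (x [ i ]≔ u) *ℙ a +ℙ φ (x [ i ]≔ v) *ℙ b) (c x u) (c x v)) ⟩
  φ (x [ i ]≔ u) *ℙ ψ (x [ i ]≔ u) +ℙ φ (x [ i ]≔ v) *ℙ ψ (x [ i ]≔ v) ∎

at-* : Disjoint b b′ d → At φ i b → At ψ i b′ → At (λ x → φ x *ℙ ψ x) i d
at-* neither at-φ at-ψ = at-*-constant at-φ at-ψ
at-* left    at-φ at-ψ = at-*-constant at-φ at-ψ
at-* {φ = φ} {ψ = ψ} right at-φ at-ψ =
  at-cong (λ x → ℙ.*-comm (ψ x) (φ x)) (at-*-constant at-ψ at-φ)

at-tail : ∀ y {φ : Vec (G n) (suc k) → Parity} → At φ (suc i) b → At (φ ∘ (y ∷_)) i b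
at-tail y (linear l)   = linear λ x → l (y ∷ x)
at-tail y (constant c) = constant λ x → c (y ∷ x)

-- Coordinates are exchanged one at a time: those in `S` already agree, and `φ` is constant in each
-- of the others.
local : Multilinear S φ → ∀ x y → (∀ i → S i ≡ true → lookup x i ≡ lookup y i) → φ x ≡ φ y
local ml [] [] agree = refl
local {S = S} {φ = φ} ml (x ∷ xs) (y ∷ ys) agree =
  trans (heads (S zero) (ml zero) (agree zero))
        (local (λ i → at-tail y (ml (suc i))) xs ys (agree ∘ suc))
  where
  heads : ∀ b → At φ zero b → (b ≡ true → x ≡ y) → φ (x ∷ xs) ≡ φ (y ∷ xs)
  heads true  _            eq = cong (λ z → φ (z ∷ xs)) (eq refl)
  heads false (constant c) _  = sym (c (x ∷ xs) y)

-- Fixing some of the variables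

mix : (Fin k → Bool) → Vec A k → Vec A k → Vec A k
mix Q []      []      = []
mix Q (p ∷ ps) (x ∷ xs) = (if Q zero then p else x) ∷ mix (Q ∘ suc) ps xs

lookup-mix : ∀ (Q : Fin k → Bool) (p x : Vec A k) i →
             lookup (mix Q p x) i ≡ (if Q i then lookup p i else lookup x i)
lookup-mix Q (p ∷ ps) (x ∷ xs) zero    = refl
lookup-mix Q (p ∷ ps) (x ∷ xs) (suc i) = lookup-mix (Q ∘ suc) ps xs i

mix-update-inside : ∀ (Q : Fin k → Bool) (p x : Vec A k) i u → Q i ≡ true →
                    mix Q p (x [ i ]≔ u) ≡ mix Q p x
mix-update-inside Q (p ∷ ps) (x ∷ xs) zero    u eq rewrite eq = refl
mix-update-inside Q (p ∷ ps) (x ∷ xs) (suc i) u eq =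
  cong (_ ∷_) (mix-update-inside (Q ∘ suc) ps xs i u eq)

mix-update-outside : ∀ (Q : Fin k → Bool) (p x : Vec A k) i u → Q i ≡ false →
                     mix Q p (x [ i ]≔ u) ≡ mix Q p x [ i ]≔ u
mix-update-outside Q (p ∷ ps) (x ∷ xs) zero    u eq rewrite eq = refl
mix-update-outside Q (p ∷ ps) (x ∷ xs) (suc i) u eq =
  cong (_ ∷_) (mix-update-outside (Q ∘ suc) ps xs i u eq)

multilinear-mix : ∀ (Q : Fin k → Bool) p → Multilinear S φ →
                  Multilinear (λ i → not (Q i) ∧ S i) (φ ∘ mix Q p)
multilinear-mix {S = S} {φ = φ} Q p ml i with Q i in eq
... | true  = constant λ x u → cong φ (mix-update-inside Q p x i u eq)
... | false with S i | ml i
...   | true  | linear l = linear λ x u v →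
  trans (cong φ (mix-update-outside Q p x i (u +ᴳ v) eq))
    (trans (l (mix Q p x) u v)
           (sym (cong₂ _+ℙ_ (cong φ (mix-update-outside Q p x i u eq))
                            (cong φ (mix-update-outside Q p x i v eq)))))
...   | false | constant c = constant λ x u →
  trans (cong φ (mix-update-outside Q p x i u eq)) (c (mix Q p x) u)

mix-fixed : ∀ (Q : Fin k → Bool) p → Multilinear Q φ → ∀ x → φ (mix Q p x) ≡ φ p
mix-fixed Q p ml x = local ml (mix Q p x) p λ i eq →
  trans (lookup-mix Q p x i) (cong (λ b → if b then lookup p i else lookup x i) eq)

mix-free : ∀ (Q : Fin k → Bool) p → Multilinear (not ∘ Q) φ → ∀ x → φ (mix Q p x) ≡ φ x
mix-free Q p ml x = local ml (mix Q p x) x λ i → agree i (lookup-mix Q p x i)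
  where
  agree : ∀ i → lookup (mix Q p x) i ≡ (if Q i then lookup p i else lookup x i) →
          not (Q i) ≡ true → lookup (mix Q p x) i ≡ lookup x i
  agree i eq eq′ with Q i
  ... | false = eq

-- Interpolation gives `u i x` as the sum of `u i (p j) *ℙ w j x`. Fixing `Q` at `p j` leaves `f i`
-- alone and turns `u i` into the constant `u i (p j)`, so after swapping the sums the coefficient
-- of `w j` is the whole sum with `Q` fixed. Only that whole sum enters on the right, so it can be
-- replaced by anything known to equal it.
extract : ∀ (Q : Fin k → Bool) (f u : Fin m → Vec (G n) k → Parity) →
  (∀ i → Multilinear (not ∘ Q) (f i)) → (∀ i → Multilinear Q (u i)) →
  Σ[ p ∈ (Fin m → Vec (G n) k) ] Σ[ w ∈ (Fin m → Vec (G n) k → Parity) ]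
    ((∀ j → Span u (w j)) ×
     (∀ x → ∑ᶠ (λ i → f i x *ℙ u i x) ≡
            ∑ᶠ (λ j → w j x *ℙ ∑ᶠ (λ i → f i (mix Q (p j) x) *ℙ u i (mix Q (p j) x)))))
extract {k = k} {m = m} {n = n} Q f u mf mu
  with interpolate find-nonzero (replicate k (replicate n 0ℙ)) u
... | p , w , sp , eq = p , w , sp , λ x → begin
  ∑ᶠ (λ i → f i x *ℙ u i x)
    ≡⟨ ∑-cong (allFin m) (λ i → trans (cong (f i x *ℙ_) (eq i x)) (sym (∑-*ˡ (allFin m) (f i x) _))) ⟩
  ∑ᶠ (λ i → ∑ᶠ (λ j → f i x *ℙ (u i (p j) *ℙ w j x)))
    ≡⟨ ∑-swap (allFin m) (allFin m) _ ⟩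
  ∑ᶠ (λ j → ∑ᶠ (λ i → f i x *ℙ (u i (p j) *ℙ w j x)))
    ≡⟨ ∑-cong (allFin m) (λ j → trans (∑-cong (allFin m) (λ i →
         trans (solve 3 (λ a b c → a :* (b :* c) := c :* (a :* b)) refl (f i x) (u i (p j)) (w j x))
               (sym (cong (w j x *ℙ_) (cong₂ _*ℙ_ (mix-free Q (p j) (mf i) x)
                                                 (mix-fixed Q (p j) (mu i) x))))))
         (∑-*ˡ (allFin m) (w j x) _)) ⟩
  ∑ᶠ (λ j → w j x *ℙ ∑ᶠ (λ i → f i (mix Q (p j) x) *ℙ u i (mix Q (p j) x))) ∎

-- Deciding the partition rank

0ᴳ+0ᴳ≡0ᴳ : ∀ (u : G n) → (0ℙ ·ᴳ u) +ᴳ (0ℙ ·ᴳ u) ≡ 0ℙ ·ᴳ u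
0ᴳ+0ᴳ≡0ᴳ []      = refl
0ᴳ+0ᴳ≡0ᴳ (_ ∷ u) = cong (0ℙ ∷_) (0ᴳ+0ᴳ≡0ᴳ u)

1·ᴳ : ∀ (u : G n) → 1ℙ ·ᴳ u ≡ u
1·ᴳ []      = refl
1·ᴳ (a ∷ u) = cong (a ∷_) (1·ᴳ u)

-- Over 𝔽₂ additivity implies homogeneity: the zero vector is its own double, so its value is a sum
-- of two equal parities.
toForm : (φ : Vec (G n) k → Parity) → Multilinear everywhere φ → MultilinearForm n k
toForm {n} {k} φ ml = record { ⟦_⟧ = φ ; additive = add ; homogeneous = hom }
  where
  add : ∀ x i u v → φ (x [ i ]≔ (u +ᴳ v)) ≡ φ (x [ i ]≔ u) +ℙ φ (x [ i ]≔ v)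
  add x i u v with ml i
  ... | linear l = l x u v
  hom : ∀ x i c u → φ (x [ i ]≔ (c ·ᴳ u)) ≡ c *ℙ φ (x [ i ]≔ u)
  hom x i 0ℙ u = begin
    φ (x [ i ]≔ 0u)                      ≡⟨ cong (λ z → φ (x [ i ]≔ z)) (sym (0ᴳ+0ᴳ≡0ᴳ u)) ⟩
    φ (x [ i ]≔ (0u +ᴳ 0u))              ≡⟨ add x i 0u 0u ⟩
    φ (x [ i ]≔ 0u) +ℙ φ (x [ i ]≔ 0u)   ≡⟨ ℙ.p+p≡0ℙ (φ (x [ i ]≔ 0u)) ⟩
    0ℙ                                   ∎
    where 0u = 0ℙ ·ᴳ u
  hom x i 1ℙ u = cong (λ z → φ (x [ i ]≔ z)) (1·ᴳ u)

multilinear : (φ : MultilinearForm n k) → Multilinear everywhere ⟦ φ ⟧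
multilinear φ i = linear λ x u v → additive φ x i u v

multilinear? : (φ : Vec (G n) k → Parity) → Dec (Multilinear everywhere φ)
multilinear? {n} {k} φ = map′
  (λ add i → linear (λ x u v → add i x u v))
  (λ ml i x u v → additive (toForm φ ml) x i u v)
  (∀? (allFin k , ∈-allFin) λ i → ∀? (points n k) λ x →
   ∀? (vectors parities n) λ u → ∀? (vectors parities n) λ v →
   φ (x [ i ]≔ (u +ᴳ v)) ℙ.≟ φ (x [ i ]≔ u) +ℙ φ (x [ i ]≔ v))

∃-form? : {P : MultilinearForm n k → Set} →
          (∀ {φ ψ} → ⟦ φ ⟧ ≗ ⟦ ψ ⟧ → P φ → P ψ) → (∀ φ → Dec (P φ)) → Dec (∃ P)
∃-form? {n} {k} {P} resp P? = map′
  (λ (φ , ml , p) → toForm φ ml , p)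
  (λ (φ , p) → ⟦ φ ⟧ , multilinear φ , resp (λ _ → refl) p)
  (∃-function? (points n k) _≟ⱽ_ {P = λ φ → Σ[ ml ∈ Multilinear everywhere φ ] P (toForm φ ml)}
    (λ eq (ml , p) → (λ i → at-cong eq (ml i)) , resp eq p)
    dec)
  where
  dec : ∀ φ → Dec (Σ[ ml ∈ Multilinear everywhere φ ] P (toForm φ ml))
  dec φ with multilinear? φ
  ... | no ¬ml = no (¬ml ∘ proj₁)
  -- Different proofs `ml′` and `ml` give different records with the same values, so `resp` carries
  -- `P` across.
  ... | yes ml = map′ (ml ,_) (λ (ml′ , p) → resp (λ _ → refl) p) (P? (toForm φ ml))

∃-split? : {P : (Vec (G n) k → Parity) → Set} →
           (∀ {φ ψ} → φ ≗ ψ → P φ → P ψ) → (∀ φ → Dec (P φ)) →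
           Dec (∃[ s ] P (SplitProduct.value {n} {k} s))
∃-split? {n} {k} {P} resp P? = map′
  (λ (I , ne , pr , β , γ , p) → record { I = I ; nonempty = ne ; proper = pr ; β = β ; γ = γ } , p)
  (λ (s , p) → let open SplitProduct s in I , nonempty , proper , β , γ , p)
  (anySubset? dec)
  where
  Rest : Subset k → Set
  Rest I = Σ[ β ∈ MultilinearForm n ∣ I ∣ ] Σ[ γ ∈ MultilinearForm n ∣ ∁ I ∣ ]
             P (λ x → ⟦ β ⟧ (x ↾ I) *ℙ ⟦ γ ⟧ (x ↾ ∁ I))
  rest? : ∀ I → Dec (Rest I)
  rest? I = ∃-form?
    (λ eq (γ , p) → γ , resp (λ x → cong (_*ℙ _) (eq (x ↾ I))) p)
    (λ β → ∃-form? (λ eq → resp (λ x → cong (⟦ β ⟧ (x ↾ I) *ℙ_) (eq (x ↾ ∁ I)))) (λ γ → P? _))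
  dec : ∀ I → Dec (Nonempty I × I ⊂ ⊤ × Rest I)
  dec I = nonempty? I ×-dec (I ⊂? ⊤) ×-dec rest? I

SumOfSplits : (Vec (G n) k → Parity) → ℕ → Set
SumOfSplits {n} {k} φ m =
  Σ[ s ∈ (Fin m → SplitProduct n k) ] (∀ x → φ x ≡ sum (λ i → SplitProduct.value (s i) x))

-- One product is searched for at a time. Since addition is its own inverse, `φ` is a sum of `suc m`
-- products exactly when adding a suitable product leaves a sum of `m`.
sumOfSplits? : (φ : Vec (G n) k → Parity) → ∀ m → Dec (SumOfSplits φ m)
sumOfSplits? {n} {k} φ zero = map′ ((λ ()) ,_) proj₂ (∀? (points n k) (λ x → φ x ℙ.≟ 0ℙ))
sumOfSplits? {n} {k} φ (suc m) = map′ add remove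
  (∃-split? {P = λ ψ → SumOfSplits (λ x → ψ x +ℙ φ x) m}
    (λ eq (s , eq′) → s , λ x → trans (cong (_+ℙ φ x) (sym (eq x))) (eq′ x))
    (λ ψ → sumOfSplits? (λ x → ψ x +ℙ φ x) m))
  where
  open SplitProduct using (value)
  add : ∃[ s ] SumOfSplits (λ x → value s x +ℙ φ x) m → SumOfSplits φ (suc m)
  add (s , ss , eq) = (λ { zero → s ; (suc i) → ss i }) , λ x →
    trans (solve 2 (λ a b → b := a :+ (a :+ b)) refl (value s x) (φ x))
          (cong (value s x +ℙ_) (eq x))
  remove : SumOfSplits φ (suc m) → ∃[ s ] SumOfSplits (λ x → value s x +ℙ φ x) m
  remove (ss , eq) = ss zero , ss ∘ suc , λ x →
    trans (cong (value (ss zero) x +ℙ_) (eq x))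
          (solve 2 (λ a b → a :+ (a :+ b) := b) refl (value (ss zero) x) _)

-- The reduction only bounds the length of a decomposition, while `IsPrank` demands the exact
-- minimum. Decidability of each length supplies that minimum constructively.
∃-prank : (α : MultilinearForm n k) → HasDecomposition α N → ∃[ p ] (IsPrank α p × p ≤ N)
∃-prank α dec with least (sumOfSplits? ⟦ α ⟧) dec
... | p , hd , min = p , (hd , min) , min _ dec

-- Products as functions of all variables

pad : (I : Subset k) → Vec (G n) ∣ I ∣ → Vec (G n) k
pad []            []       = []
pad (inside  ∷ I) (x ∷ xs) = x ∷ pad I xs
pad (outside ∷ I) xs       = replicate _ 0ℙ ∷ pad I xs

pad-update : ∀ (I : Subset k) i → Σ[ j ∈ Fin k ] (lookup I j ≡ true ×
             (∀ (x : Vec (G n) ∣ I ∣) u → pad I (x [ i ]≔ u) ≡ pad I x [ j ]≔ u))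
pad-update (inside ∷ I) zero = zero , refl , λ { (x ∷ xs) u → refl }
pad-update {n = n} (inside ∷ I) (suc i) with pad-update {n = n} I i
... | j , j∈ , eq = suc j , j∈ , λ { (x ∷ xs) u → cong (x ∷_) (eq xs u) }
pad-update {n = n} (outside ∷ I) i with pad-update {n = n} I i
... | j , j∈ , eq = suc j , j∈ , λ x u → cong (_ ∷_) (eq x u)

lookup-pad : ∀ (I : Subset k) (x : Vec (G n) k) j → lookup I j ≡ true →
             lookup (pad I (x ↾ I)) j ≡ lookup x j
lookup-pad (inside  ∷ I) (x ∷ xs) zero    j∈ = refl
lookup-pad (inside  ∷ I) (x ∷ xs) (suc j) j∈ = lookup-pad I xs j j∈
lookup-pad (outside ∷ I) (x ∷ xs) (suc j) j∈ = lookup-pad I xs j j∈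

-- By `local` the values off `I` do not matter, so they can be filled with zeros.
restrict : ∀ (I : Subset k) {φ : Vec (G n) k → Parity} → Multilinear (lookup I) φ →
           Σ[ β ∈ MultilinearForm n ∣ I ∣ ] (∀ x → ⟦ β ⟧ (x ↾ I) ≡ φ x)
restrict {k} {n} I {φ} ml = toForm (φ ∘ pad I) (λ i → linear (add i)) ,
    λ x → local ml (pad I (x ↾ I)) x (lookup-pad I x)
  where
  add : ∀ i x u v → φ (pad I (x [ i ]≔ (u +ᴳ v))) ≡ φ (pad I (x [ i ]≔ u)) +ℙ φ (pad I (x [ i ]≔ v))
  add i x u v with pad-update {n = n} I i
  ... | j , j∈ , eq with lookup I j | j∈ | ml j
  ... | true | _ | linear l rewrite eq x (u +ᴳ v) | eq x u | eq x v = l (pad I x) u v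

↾-update-inside : ∀ (I : Subset k) j → lookup I j ≡ true →
  Σ[ i ∈ Fin ∣ I ∣ ] (∀ (x : Vec (G n) k) u → (x [ j ]≔ u) ↾ I ≡ (x ↾ I) [ i ]≔ u)
↾-update-inside (inside ∷ I) zero j∈ = zero , λ { (x ∷ xs) u → refl }
↾-update-inside {n = n} (inside ∷ I) (suc j) j∈ with ↾-update-inside {n = n} I j j∈
... | i , eq = suc i , λ { (x ∷ xs) u → cong (x ∷_) (eq xs u) }
↾-update-inside {n = n} (outside ∷ I) (suc j) j∈ with ↾-update-inside {n = n} I j j∈
... | i , eq = i , λ { (x ∷ xs) u → eq xs u }

↾-update-outside : ∀ (I : Subset k) j → lookup I j ≡ false →
  ∀ (x : Vec (G n) k) u → (x [ j ]≔ u) ↾ I ≡ x ↾ I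
↾-update-outside (outside ∷ I) zero    j∉ (x ∷ xs) u = refl
↾-update-outside (inside  ∷ I) (suc j) j∉ (x ∷ xs) u = cong (x ∷_) (↾-update-outside I j j∉ xs u)
↾-update-outside (outside ∷ I) (suc j) j∉ (x ∷ xs) u = ↾-update-outside I j j∉ xs u

multilinear-↾ : ∀ (I : Subset k) (β : MultilinearForm n ∣ I ∣) →
                Multilinear (lookup I) (λ x → ⟦ β ⟧ (x ↾ I))
multilinear-↾ {n = n} I β j with lookup I j in eq
... | false = constant λ x u → cong ⟦ β ⟧ (↾-update-outside I j eq x u)
... | true with ↾-update-inside {n = n} I j eq
...   | i , upd = linear λ x u v →
  trans (cong ⟦ β ⟧ (upd x (u +ᴳ v)))
    (trans (additive β (x ↾ I) i u v)
           (sym (cong₂ _+ℙ_ (cong ⟦ β ⟧ (upd x u)) (cong ⟦ β ⟧ (upd x v)))))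

-- The counterpart of `SplitProduct` whose factors take all `k` variables; `in₀` and `out₀` say that
-- the partition is non-trivial.
record Split (n k : ℕ) : Set where
  field
    P       : Fin k → Bool
    in₀     : ∃[ i ] P i ≡ true
    out₀    : ∃[ i ] P i ≡ false
    β γ     : Vec (G n) k → Parity
    β-multi : Multilinear P β
    γ-multi : Multilinear (not ∘ P) γ

  value : Vec (G n) k → Parity
  value x = β x *ℙ γ x

fromSplitProduct : (s : SplitProduct n k) → Σ[ t ∈ Split n k ] (SplitProduct.value s ≗ Split.value t)
fromSplitProduct {n} {k} s = record
  { P = lookup I
  ; in₀ = proj₁ nonempty , []=⇒lookup (proj₂ nonempty)
  ; out₀ = let i , _ , i∉ = proj₂ proper in i , outside-I i i∉
  ; β-multi = multilinear-↾ I β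
  ; γ-multi = multilinear-cong (λ i → lookup-map i not I) (multilinear-↾ (∁ I) γ)
  } , λ _ → refl
  where
  open SplitProduct s
  outside-I : ∀ i → i ∉ I → lookup I i ≡ false
  outside-I i i∉ with lookup I i in eq
  ... | true  = contradiction (lookup⇒[]= i I eq) i∉
  ... | false = refl

toSplitProduct : (t : Split n k) → Σ[ s ∈ SplitProduct n k ] (SplitProduct.value s ≗ Split.value t)
toSplitProduct {n} {k} t = record
  { I = I
  ; nonempty = let i , i∈ = in₀ in i , lookup⇒[]= i I (trans (lookup∘tabulate P i) i∈)
  ; proper = ⊆⊤ , (let i , i∉ = out₀ in i , ∈⊤ , λ i∈ →
      contradiction (trans (sym ([]=⇒lookup i∈)) (trans (lookup∘tabulate P i) i∉)) λ ())
  ; β = proj₁ βI ; γ = proj₁ γI } , λ x → cong₂ _*ℙ_ (proj₂ βI x) (proj₂ γI x)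
  where
  open Split t
  I : Subset k
  I = tabulate P
  βI = restrict I (multilinear-cong (λ i → sym (lookup∘tabulate P i)) β-multi)
  γI = restrict (∁ I) (multilinear-cong
         (λ i → sym (trans (lookup-map i not I) (cong not (lookup∘tabulate P i)))) γ-multi)

fromDecomposition : (α : MultilinearForm n k) → HasDecomposition α m →
  Σ[ ts ∈ List (Split n k) ] (length ts ≡ m × (∀ x → ⟦ α ⟧ x ≡ ∑ ts (λ t → Split.value t x)))
fromDecomposition {m = m} α (s , eq) =
  List.map t (allFin m) , trans (length-map t (allFin m)) (length-tabulate id) , λ x →
  trans (eq x) (trans (sum≡∑ᶠ (λ i → SplitProduct.value (s i) x))
    (trans (∑-cong (allFin m) (λ i → proj₂ (fromSplitProduct (s i)) x))
           (sym (∑-map t (allFin m) (λ t → Split.value t x)))))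
  where
  t : Fin m → Split _ _
  t i = proj₁ (fromSplitProduct (s i))

toDecomposition : (α : MultilinearForm n k) (ts : List (Split n k)) →
  (∀ x → ⟦ α ⟧ x ≡ ∑ ts (λ t → Split.value t x)) → HasDecomposition α (length ts)
toDecomposition α ts eq = (λ i → proj₁ (toSplitProduct (List.lookup ts i))) , λ x →
  trans (eq x) (trans (sym (∑ᶠ-lookup ts (λ t → Split.value t x)))
    (trans (∑-cong (allFin (length ts)) (λ i → sym (proj₂ (toSplitProduct (List.lookup ts i)) x)))
           (sym (sum≡∑ᶠ (λ i → SplitProduct.value (proj₁ (toSplitProduct (List.lookup ts i))) x)))))

-- Product types

-- A linear extension of inclusion with values below `2 ^ k`. Being injective, it makes all products
-- of maximal code share one set, so that a single extraction treats them together, and it turns the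
-- descent over subsets into induction on a number.
code : (Fin k → Bool) → ℕ
code {zero}  S = 0
code {suc k} S = (if S zero then 1 else 0) ℕ.+ 2 ℕ.* code (S ∘ suc)

code-mono : (∀ i → S i ≡ true → S′ i ≡ true) → code S ≤ code S′
code-mono {zero} sub = z≤n
code-mono {suc k} {S} {S′} sub =
  ℕ.+-mono-≤ (bit (S zero) (S′ zero) (sub zero)) (ℕ.*-monoʳ-≤ 2 (code-mono (sub ∘ suc)))
  where
  bit : ∀ b b′ → (b ≡ true → b′ ≡ true) → (if b then 1 else 0) ≤ (if b′ then 1 else 0)
  bit false b′    _  = z≤n
  bit true  true  _  = s≤s z≤n
  bit true  false eq = contradiction (eq refl) λ ()

code-cong : (∀ i → S i ≡ S′ i) → code S ≡ code S′
code-cong eq = ℕ.≤-antisym (code-mono (λ i → trans (sym (eq i)))) (code-mono (λ i → trans (eq i)))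

code-injective : {S S′ : Fin k → Bool} → code S ≡ code S′ → ∀ i → S i ≡ S′ i
code-injective {suc k} {S} {S′} eq i with S zero in z | S′ zero in z′ | i
... | true  | true  | zero  = trans z (sym z′)
... | false | false | zero  = trans z (sym z′)
... | true  | true  | suc i = code-injective (ℕ.*-cancelˡ-≡ _ _ 2 (ℕ.suc-injective eq)) i
... | false | false | suc i = code-injective (ℕ.*-cancelˡ-≡ _ _ 2 eq) i
... | true  | false | _     = contradiction (sym eq) (ℕ.even≢odd (code (S′ ∘ suc)) (code (S ∘ suc)))
... | false | true  | _     = contradiction eq (ℕ.even≢odd (code (S ∘ suc)) (code (S′ ∘ suc)))

code-∅ : ∀ k → code {k} (λ _ → false) ≡ 0
code-∅ zero    = refl
code-∅ (suc k) = cong (2 ℕ.*_) (code-∅ k)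

code<2^k : (S : Fin k → Bool) → code S ℕ.< 2 ℕ.^ k
code<2^k {zero}  S = s≤s z≤n
code<2^k {suc k} S = ℕ.≤-trans (s≤s (ℕ.+-monoˡ-≤ (2 ℕ.* code (S ∘ suc)) (bit (S zero))))
  (ℕ.≤-trans (ℕ.≤-reflexive (sym (ℕ.*-suc 2 (code (S ∘ suc))))) (ℕ.*-monoʳ-≤ 2 (code<2^k (S ∘ suc))))
  where
  bit : ∀ b → (if b then 1 else 0) ≤ 1
  bit true  = s≤s z≤n
  bit false = z≤n

-- Exchange of the first two variables

exchange : Vec A (2 ℕ.+ k) → Vec A (2 ℕ.+ k)
exchange (x ∷ y ∷ z) = y ∷ x ∷ z

exchangeᶠ : Fin (2 ℕ.+ k) → Fin (2 ℕ.+ k)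
exchangeᶠ 0F            = 1F
exchangeᶠ 1F            = 0F
exchangeᶠ (suc (suc i)) = suc (suc i)

exchange-update : ∀ (x : Vec A (2 ℕ.+ k)) i u → exchange (x [ i ]≔ u) ≡ exchange x [ exchangeᶠ i ]≔ u
exchange-update (_ ∷ _ ∷ _) 0F            u = refl
exchange-update (_ ∷ _ ∷ _) 1F            u = refl
exchange-update (_ ∷ _ ∷ _) (suc (suc i)) u = refl

exchange-involutive : ∀ (x : Vec A (2 ℕ.+ k)) → exchange (exchange x) ≡ x
exchange-involutive (_ ∷ _ ∷ _) = refl

at-exchange : {φ : Vec (G n) (2 ℕ.+ k) → Parity} → At φ (exchangeᶠ i) b → At (φ ∘ exchange) i b
at-exchange {i = i} {φ = φ} (linear l) = linear λ x u v →
  trans (cong φ (exchange-update x i (u +ᴳ v)))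
    (trans (l (exchange x) u v)
           (sym (cong₂ _+ℙ_ (cong φ (exchange-update x i u)) (cong φ (exchange-update x i v)))))
at-exchange {i = i} {φ = φ} (constant c) = constant λ x u →
  trans (cong φ (exchange-update x i u)) (c (exchange x) u)

asymmetry : (Vec (G n) (2 ℕ.+ k) → Parity) → Vec (G n) (2 ℕ.+ k) → Parity
asymmetry φ x = φ x +ℙ φ (exchange x)

asymmetry-exchange : ∀ (φ : Vec (G n) (2 ℕ.+ k) → Parity) x → asymmetry φ (exchange x) ≡ asymmetry φ x
asymmetry-exchange φ x = trans (ℙ.+-comm (φ (exchange x)) _)
                               (cong (λ y → φ y +ℙ φ (exchange x)) (exchange-involutive x))

SplitRank≤ : ℕ → (Vec (G n) k → Parity) → Set
SplitRank≤ {n} {k} N φ =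
  Σ[ ts ∈ List (Split n k) ] (length ts ≤ N × (∀ x → φ x ≡ ∑ ts (λ t → Split.value t x)))

splitRank-weaken : m ≤ N → SplitRank≤ m φ → SplitRank≤ N φ
splitRank-weaken le (ts , len , eq) = ts , ℕ.≤-trans len le , eq

splitRank-+ : SplitRank≤ m φ → SplitRank≤ N ψ → SplitRank≤ (m ℕ.+ N) (λ x → φ x +ℙ ψ x)
splitRank-+ (ts , len , eq) (ts′ , len′ , eq′) =
  ts ++ ts′ , ℕ.≤-trans (ℕ.≤-reflexive (length-++ ts)) (ℕ.+-mono-≤ len len′) , λ x →
  trans (cong₂ _+ℙ_ (eq x) (eq′ x)) (sym (∑-++ ts ts′ _))

splitRank-cong : φ ≗ ψ → SplitRank≤ N φ → SplitRank≤ N ψ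
splitRank-cong eq (ts , len , eq′) = ts , len , λ x → trans (sym (eq x)) (eq′ x)

splitRank-∑ : (xs : List A) (t : A → Split n k) →
              SplitRank≤ (length xs) (λ x → ∑ xs (λ a → Split.value (t a) x))
splitRank-∑ xs t = List.map t xs , ℕ.≤-reflexive (length-map t xs) , λ x →
                   sym (∑-map t xs _)

length-concatMap : ∀ (g : A → List B) {c} → (∀ x → length (g x) ≡ c) → ∀ xs →
                   length (concatMap g xs) ≡ length xs ℕ.* c
length-concatMap g len []       = refl
length-concatMap g len (x ∷ xs) =
  trans (length-++ (g x)) (cong₂ ℕ._+_ (len x) (length-concatMap g len xs))

length-allFin : ∀ m → length (allFin m) ≡ m
length-allFin m = length-tabulate id

record Separation {A B C : Set} (cls : A → B ⊎ C) (xs : List A) : Set where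
  field
    lefts    : List B
    rights   : List C
    lengths  : length lefts ℕ.+ length rights ≡ length xs
    ∑-separate : ∀ (fᴮ : B → Parity) (fᶜ : C → Parity) →
                 ∑ xs (λ x → [ fᴮ , fᶜ ]′ (cls x)) ≡ ∑ lefts fᴮ +ℙ ∑ rights fᶜ

separate : ∀ {C : Set} (cls : A → B ⊎ C) xs → Separation cls xs
separate cls [] = record { lefts = [] ; rights = [] ; lengths = refl ; ∑-separate = λ _ _ → refl }
separate cls (x ∷ xs) with cls x in eq | separate cls xs
... | inj₁ b | sep = record
  { lefts = b ∷ lefts ; rights = rights ; lengths = cong suc lengths
  ; ∑-separate = λ fᴮ fᶜ → trans (cong₂ _+ℙ_ (cong [ fᴮ , fᶜ ]′ eq) (∑-separate fᴮ fᶜ))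
                                 (sym (ℙ.+-assoc (fᴮ b) _ _)) }
  where open Separation sep
... | inj₂ c | sep = record
  { lefts = lefts ; rights = c ∷ rights
  ; lengths = trans (ℕ.+-suc (length lefts) (length rights)) (cong suc lengths)
  ; ∑-separate = λ fᴮ fᶜ → trans (cong₂ _+ℙ_ (cong [ fᴮ , fᶜ ]′ eq) (∑-separate fᴮ fᶜ))
      (solve 3 (λ a b c → a :+ (b :+ c) := b :+ (a :+ c)) refl (fᶜ c) (∑ lefts fᴮ) (∑ rights fᶜ)) }
  where open Separation sep

-- Bundled and crossed products

upper : (Fin k → Bool) → Fin (2 ℕ.+ k) → Bool
upper M 0F            = true
upper M 1F            = true
upper M (suc (suc i)) = M i

-- h (x , y , z_M) g (z_{Mᶜ})
record Bundled (n k : ℕ) : Set where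
  field
    M       : Fin k → Bool
    proper  : ∃[ i ] M i ≡ false
    h g     : Vec (G n) (2 ℕ.+ k) → Parity
    h-multi : Multilinear (upper M) h
    g-multi : Multilinear (not ∘ upper M) g

  value : Vec (G n) (2 ℕ.+ k) → Parity
  value x = h x *ℙ g x

data Colour : Set where
  X Y Z : Colour

isX isY isZ : Colour → Bool
isX X = true
isX _ = false
isY Y = true
isY _ = false
isZ Z = true
isZ _ = false

colour : (Fin k → Colour) → Fin (2 ℕ.+ k) → Colour
colour c 0F            = X
colour c 1F            = Y
colour c (suc (suc i)) = c i

-- f (x , z_X) g (y , z_Y) h (z_Z), where X, Y and Z are the colour classes.
record Crossed (n k : ℕ) : Set where
  field
    c       : Fin k → Colour
    f g h   : Vec (G n) (2 ℕ.+ k) → Parity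
    f-multi : Multilinear (isX ∘ colour c) f
    g-multi : Multilinear (isY ∘ colour c) g
    h-multi : Multilinear (isZ ∘ colour c) h

  codeX codeY : ℕ
  codeX = code (isX ∘ c)
  codeY = code (isY ∘ c)

  value : Vec (G n) (2 ℕ.+ k) → Parity
  value x = f x *ℙ (g x *ℙ h x)

  gh-multi : Multilinear (not ∘ isX ∘ colour c) (λ x → g x *ℙ h x)
  gh-multi i = at-* (disjoint (colour c i)) (g-multi i) (h-multi i)
    where
    disjoint : ∀ κ → Disjoint (isY κ) (isZ κ) (not (isX κ))
    disjoint X = neither
    disjoint Y = left
    disjoint Z = right

  toSplit : Split n (2 ℕ.+ k)
  toSplit = record
    { P = isX ∘ colour c ; in₀ = 0F , refl ; out₀ = 1F , refl
    ; β = f ; γ = λ x → g x *ℙ h x ; β-multi = f-multi ; γ-multi = gh-multi }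

flip : Colour → Colour
flip X = Y
flip Y = X
flip Z = Z

-- The composite with `exchange` is again crossed: the factor in `y` now reads `x`, so `f` and `g`
-- trade places and the classes `X` and `Y` with them.
transposed : Crossed n k → Crossed n k
transposed t = record
  { c = flip ∘ c ; f = g ∘ exchange ; g = f ∘ exchange ; h = h ∘ exchange
  ; f-multi = λ i → at-exchange (subst (At g _) (Y→X i) (g-multi (exchangeᶠ i)))
  ; g-multi = λ i → at-exchange (subst (At f _) (X→Y i) (f-multi (exchangeᶠ i)))
  ; h-multi = λ i → at-exchange (subst (At h _) (Z→Z i) (h-multi (exchangeᶠ i))) }
  where
  open Crossed t
  Y→X : ∀ i → isY (colour c (exchangeᶠ i)) ≡ isX (colour (flip ∘ c) i)
  Y→X 0F = refl
  Y→X 1F = refl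
  Y→X (suc (suc i)) with c i
  ... | X = refl
  ... | Y = refl
  ... | Z = refl
  X→Y : ∀ i → isX (colour c (exchangeᶠ i)) ≡ isY (colour (flip ∘ c) i)
  X→Y 0F = refl
  X→Y 1F = refl
  X→Y (suc (suc i)) with c i
  ... | X = refl
  ... | Y = refl
  ... | Z = refl
  Z→Z : ∀ i → isZ (colour c (exchangeᶠ i)) ≡ isZ (colour (flip ∘ c) i)
  Z→Z 0F = refl
  Z→Z 1F = refl
  Z→Z (suc (suc i)) with c i
  ... | X = refl
  ... | Y = refl
  ... | Z = refl

transposed-value : ∀ (t : Crossed n k) x → Crossed.value (transposed t) x ≡ Crossed.value t (exchange x)
transposed-value t x =
  solve 3 (λ a b c → a :* (b :* c) := b :* (a :* c)) refl (g (exchange x)) (f (exchange x)) (h (exchange x))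
  where open Crossed t

transposed-codeX : ∀ (t : Crossed n k) → Crossed.codeX (transposed t) ≡ Crossed.codeY t
transposed-codeX t = code-cong (λ i → eq (Crossed.c t i))
  where
  eq : ∀ κ → isX (flip κ) ≡ isY κ
  eq X = refl
  eq Y = refl
  eq Z = refl

transposed-codeY : ∀ (t : Crossed n k) → Crossed.codeY (transposed t) ≡ Crossed.codeX t
transposed-codeY t = code-cong (λ i → eq (Crossed.c t i))
  where
  eq : ∀ κ → isY (flip κ) ≡ isX κ
  eq X = refl
  eq Y = refl
  eq Z = refl

complement : Split n k → Split n k
complement t = record
  { P = not ∘ P ; in₀ = let i , eq = out₀ in i , cong not eq ; out₀ = let i , eq = in₀ in i , cong not eq
  ; β = γ ; γ = β ; β-multi = γ-multi
  ; γ-multi = multilinear-cong (λ i → sym (not-involutive (P i))) β-multi }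
  where open Split t

⟦_⟧ᶜ : Bundled n k ⊎ Crossed n k → Vec (G n) (2 ℕ.+ k) → Parity
⟦ s ⟧ᶜ x = [ (λ t → Bundled.value t x) , (λ t → Crossed.value t x) ]′ s

-- With `x` in `β`, the product is bundled or crossed according to the factor that contains `y`. In
-- `classify`, complementing the split reduces the other case to this one.
classify-with : (t : Split n (2 ℕ.+ k)) → Split.P t 0F ≡ true →
                Σ[ s ∈ Bundled n k ⊎ Crossed n k ] (∀ x → Split.value t x ≡ ⟦ s ⟧ᶜ x)
classify-with {n} {k} t p0 = go (P 1F) refl
  where
  open Split t
  go : ∀ b → P 1F ≡ b → Σ[ s ∈ Bundled n k ⊎ Crossed n k ] (∀ x → Split.value t x ≡ ⟦ s ⟧ᶜ x)
  go true p1 = inj₁ (record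
    { M = λ i → P (suc (suc i)) ; proper = proper out₀ ; h = β ; g = γ
    ; h-multi = multilinear-cong P≡ β-multi ; g-multi = multilinear-cong (cong not ∘ P≡) γ-multi }) , λ _ → refl
    where
    P≡ : ∀ i → P i ≡ upper (λ i → P (suc (suc i))) i
    P≡ 0F = p0
    P≡ 1F = p1
    P≡ (suc (suc i)) = refl
    proper : ∃[ i ] P i ≡ false → ∃[ i ] P (suc (suc i)) ≡ false
    proper (0F , eq) = contradiction (trans (sym p0) eq) λ ()
    proper (1F , eq) = contradiction (trans (sym p1) eq) λ ()
    proper (suc (suc i) , eq) = i , eq
  -- The class `Z` starts empty, with `h` the constant 1; variables enter it only through later
  -- eliminations.
  go false p1 = inj₂ (record
    { c = c ; f = β ; g = γ ; h = λ _ → 1ℙ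
    ; f-multi = multilinear-cong X≡ β-multi ; g-multi = multilinear-cong Y≡ γ-multi
    ; h-multi = λ i → subst (At _ i) (Z≡ i) (constant λ _ _ → refl) }) , λ x → cong (β x *ℙ_) (sym (ℙ.*-identityʳ (γ x)))
    where
    c : Fin k → Colour
    c i = if P (suc (suc i)) then X else Y
    X≡ : ∀ i → P i ≡ isX (colour c i)
    X≡ 0F = p0
    X≡ 1F = p1
    X≡ (suc (suc i)) with P (suc (suc i))
    ... | true  = refl
    ... | false = refl
    Y≡ : ∀ i → not (P i) ≡ isY (colour c i)
    Y≡ 0F = cong not p0
    Y≡ 1F = cong not p1
    Y≡ (suc (suc i)) with P (suc (suc i))
    ... | true  = refl
    ... | false = refl
    Z≡ : ∀ i → false ≡ isZ (colour c i)
    Z≡ 0F = refl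
    Z≡ 1F = refl
    Z≡ (suc (suc i)) with P (suc (suc i))
    ... | true  = refl
    ... | false = refl

classify : (t : Split n (2 ℕ.+ k)) → Σ[ s ∈ Bundled n k ⊎ Crossed n k ] (∀ x → Split.value t x ≡ ⟦ s ⟧ᶜ x)
classify t with Split.P t 0F in p0
... | true  = classify-with t p0
... | false = let s , eq = classify-with (complement t) (cong not p0) in
              s , λ x → trans (ℙ.*-comm (Split.β t x) (Split.γ t x)) (eq x)

-- Elimination

multilinear-+ : ∀ {φ ψ : Vec (G n) k → Parity} → Multilinear S φ → Multilinear S ψ → Multilinear S (λ x → φ x +ℙ ψ x)
multilinear-+ mφ mψ i = at-+ (mφ i) (mψ i)

-- One bound for every kind of step: `N + N` covers products added to `α`, `N + N * N` the lists
-- after removing bundled products, and `N + N * (N * (N + N))` the list after rewriting crossed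
-- ones.
growth : ℕ → ℕ
growth N = N ℕ.+ N ℕ.+ N ℕ.* (N ℕ.* (N ℕ.+ N))

2N≤growth : ∀ N → N ℕ.+ N ≤ growth N
2N≤growth N = ℕ.m≤m+n (N ℕ.+ N) _

N≤growth : ∀ N → N ≤ growth N
N≤growth N = ℕ.≤-trans (ℕ.m≤m+n N N) (2N≤growth N)

N+2N³≤growth : ∀ N → N ℕ.+ N ℕ.* (N ℕ.* (N ℕ.+ N)) ≤ growth N
N+2N³≤growth N = ℕ.+-monoˡ-≤ (N ℕ.* (N ℕ.* (N ℕ.+ N))) (ℕ.m≤m+n N N)

N+N²≤growth : ∀ N → N ℕ.+ N ℕ.* N ≤ growth N
N+N²≤growth zero      = z≤n
N+N²≤growth N@(suc _) = ℕ.≤-trans (ℕ.+-monoʳ-≤ N (ℕ.*-monoʳ-≤ N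
  (ℕ.≤-trans (ℕ.m≤m+n N N) (ℕ.m≤n*m (N ℕ.+ N) N)))) (N+2N³≤growth N)

-- Once the variables outside `M` are fixed, `h` reads only the intersection of `M` with the set of
-- `t`, and `w` joins `g`. The intersection lies in the set of `t`, which gives both properness and
-- the bound on the code.
mixed-bundle : (M : Fin k → Bool) (p : Vec (G n) (2 ℕ.+ k)) (w : Vec (G n) (2 ℕ.+ k) → Parity) →
  Multilinear (not ∘ upper M) w → (t : Bundled n k) →
  Σ[ s ∈ Bundled n k ] (code (Bundled.M s) ≤ code (Bundled.M t) ×
    (∀ x → Bundled.value s x ≡ w x *ℙ Bundled.value t (mix (not ∘ upper M) p x)))
mixed-bundle {k} M p w w-multi t = record
    { M = λ i → M i ∧ M′ i
    ; proper = let i , eq = proper in i , trans (cong (M i ∧_) eq) (∧-zeroʳ (M i))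
    ; h = λ x → h (mix Q p x) ; g = λ x → w x *ℙ g (mix Q p x)
    ; h-multi = multilinear-cong h-support (multilinear-mix Q p h-multi)
    ; g-multi = λ i → at-* (g-support i) (w-multi i) (multilinear-mix Q p g-multi i) } ,
  code-mono (λ i → ∧-right (M i) (M′ i)) ,
  λ x → solve 3 (λ a b c → a :* (b :* c) := b :* (a :* c)) refl (h (mix Q p x)) (w x) (g (mix Q p x))
  where
  open Bundled t renaming (M to M′)
  Q : Fin (2 ℕ.+ k) → Bool
  Q = not ∘ upper M
  ∧-right : ∀ b b′ → b ∧ b′ ≡ true → b′ ≡ true
  ∧-right true b′ eq = eq
  h-support : ∀ i → not (Q i) ∧ upper M′ i ≡ upper (λ i → M i ∧ M′ i) i
  h-support 0F            = refl
  h-support 1F            = refl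
  h-support (suc (suc i)) = cong (_∧ M′ i) (not-involutive (M i))
  g-support : ∀ i → Disjoint (Q i) (not (Q i) ∧ not (upper M′ i)) (not (upper (λ i → M i ∧ M′ i) i))
  g-support 0F = neither
  g-support 1F = neither
  g-support (suc (suc i)) with M i | M′ i
  ... | true  | true  = neither
  ... | true  | false = right
  ... | false | _     = left

-- A crossed product stays crossed: the variables outside `M` disappear from its factors and come
-- back through `w`, which is absorbed into `h`, so they all take the colour `Z`.
mixed-cross : (M : Fin k → Bool) (p : Vec (G n) (2 ℕ.+ k)) (w : Vec (G n) (2 ℕ.+ k) → Parity) →
  Multilinear (not ∘ upper M) w → (t : Crossed n k) →
  Σ[ s ∈ Crossed n k ]
    (∀ x → Crossed.value s x ≡ w x *ℙ Crossed.value t (mix (not ∘ upper M) p x))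
mixed-cross {k} M p w w-multi t = record
    { c = c′ ; f = λ x → f (mix Q p x) ; g = λ x → g (mix Q p x) ; h = λ x → w x *ℙ h (mix Q p x)
    ; f-multi = multilinear-cong X-support (multilinear-mix Q p f-multi)
    ; g-multi = multilinear-cong Y-support (multilinear-mix Q p g-multi)
    ; h-multi = λ i → at-* (Z-support i) (w-multi i) (multilinear-mix Q p h-multi i) } ,
  λ x → solve 4 (λ a b c d → a :* (b :* (c :* d)) := c :* (a :* (b :* d))) refl
          (f (mix Q p x)) (g (mix Q p x)) (w x) (h (mix Q p x))
  where
  open Crossed t
  Q : Fin (2 ℕ.+ k) → Bool
  Q = not ∘ upper M
  c′ : Fin k → Colour
  c′ i = if M i then c i else Z
  X-support : ∀ i → not (Q i) ∧ isX (colour c i) ≡ isX (colour c′ i)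
  X-support 0F = refl
  X-support 1F = refl
  X-support (suc (suc i)) with M i
  ... | true  = refl
  ... | false = refl
  Y-support : ∀ i → not (Q i) ∧ isY (colour c i) ≡ isY (colour c′ i)
  Y-support 0F = refl
  Y-support 1F = refl
  Y-support (suc (suc i)) with M i
  ... | true  = refl
  ... | false = refl
  Z-support : ∀ i → Disjoint (Q i) (not (Q i) ∧ isZ (colour c i)) (isZ (colour c′ i))
  Z-support 0F = neither
  Z-support 1F = neither
  Z-support (suc (suc i)) with M i | c i
  ... | true  | X = neither
  ... | true  | Y = neither
  ... | true  | Z = right
  ... | false | _ = left

-- Removal of the bundled products

module Reduction {n k : ℕ} (α₀ : Vec (G n) (2 ℕ.+ k) → Parity) where

  record Approximation (N : ℕ) : Set where
    constructor approximation
    field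
      α       : Vec (G n) (2 ℕ.+ k) → Parity
      α-multi : Multilinear everywhere α
      near    : SplitRank≤ N (λ x → α₀ x +ℙ α x)

  open Approximation public

  weaken : ∀ {N N′} → N ≤ N′ → Approximation N → Approximation N′
  weaken le (approximation α α-multi near) = approximation α α-multi (splitRank-weaken le near)

  adjust : ∀ {N m} (A : Approximation N) {τ} → Multilinear everywhere τ → SplitRank≤ m τ → Approximation (N ℕ.+ m)
  adjust (approximation α α-multi near) {τ} τ-multi rank = approximation
    (λ x → α x +ℙ τ x) (multilinear-+ α-multi τ-multi)
    (splitRank-cong (λ x → ℙ.+-assoc (α₀ x) (α x) (τ x)) (splitRank-+ near rank))

  split-multi : (t : Split n (2 ℕ.+ k)) → Multilinear everywhere (Split.value t)
  split-multi t i = at-* (disjoint (P i)) (β-multi i) (γ-multi i)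
    where
    open Split t
    disjoint : ∀ b → Disjoint b (not b) true
    disjoint true  = left
    disjoint false = right

  adjust-∑ : ∀ {N} (A : Approximation N) (xs : List B) (t : B → Split n (2 ℕ.+ k)) → length xs ≤ N →
             Σ[ A′ ∈ Approximation (N ℕ.+ N) ]
               (∀ x → α A′ x ≡ α A x +ℙ ∑ xs (λ b → Split.value (t b) x))
  adjust-∑ A xs t len =
    adjust A (λ i → at-∑ xs (λ b → split-multi (t b) i)) (splitRank-weaken len (splitRank-∑ xs t)) , λ _ → refl

  Bundled< Bundled≡ : ℕ → Set
  Bundled< a = Σ[ t ∈ Bundled n k ] code (Bundled.M t) ℕ.< a
  Bundled≡ a = Σ[ t ∈ Bundled n k ] code (Bundled.M t) ≡ a

  bval : {P : Bundled n k → Set} → Vec (G n) (2 ℕ.+ k) → Σ (Bundled n k) P → Parity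
  bval x (t , _) = Bundled.value t x

  cval : Vec (G n) (2 ℕ.+ k) → Crossed n k → Parity
  cval x t = Crossed.value t x

  record BundledState (a N : ℕ) : Set where
    field
      approx   : Approximation N
      bundles  : List (Bundled< a)
      crosses  : List (Crossed n k)
      bundles≤ : length bundles ≤ N
      crosses≤ : length crosses ≤ N
      balance  : ∀ x → asymmetry (α approx) x ≡ ∑ bundles (bval x) +ℙ ∑ crosses (cval x)

  -- Let `τ` be the sum of `w j` times `α` with `Q` fixed at `p j`. As `Q` contains neither `x` nor
  -- `y`, both `w j` and the substitution commute with `exchange`, so `asymmetry τ` is the same sum
  -- with `asymmetry α` in place of `α`. Its `T` part reassembles to `T`, which cancels the `T` in
  -- `asymmetry α`; the rest is mixed products.
  eliminate-extracted : ∀ {a m N} (A : Approximation N) (M : Fin k → Bool) → ∃[ i ] M i ≡ false →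
    let Q = not ∘ upper M in
    (p : Fin m → Vec (G n) (2 ℕ.+ k)) (w : Fin m → Vec (G n) (2 ℕ.+ k) → Parity) →
    (∀ j → Multilinear Q (w j)) → (T : Vec (G n) (2 ℕ.+ k) → Parity) →
    (∀ x → T x ≡ ∑ᶠ (λ j → w j x *ℙ T (mix Q (p j) x))) →
    (rest : List (Bundled< a)) (crosses : List (Crossed n k)) →
    m ≤ N → length rest ≤ N → length crosses ≤ N →
    (∀ x → asymmetry (α A) x ≡ T x +ℙ ∑ rest (bval x) +ℙ ∑ crosses (cval x)) →
    BundledState a (growth N)
  eliminate-extracted {a} {m} {N} A M proper p w w-multi T T-extracted rest crosses m≤N rest≤N len′ bal = result
    where
    Q : Fin (2 ℕ.+ k) → Bool
    Q = not ∘ upper M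
    R : Vec (G n) (2 ℕ.+ k) → Parity
    R x = ∑ rest (bval x) +ℙ ∑ crosses (cval x)
    -- Properness of `M` makes `Q` nonempty, and `x` lies outside `Q`, so each summand of `τ` is a
    -- single product of partition rank at most 1.
    split : Fin m → Split n (2 ℕ.+ k)
    split j = record
      { P = Q ; in₀ = let i , eq = proper in suc (suc i) , cong not eq ; out₀ = 0F , refl
      ; β = w j ; γ = λ x → α A (mix Q (p j) x) ; β-multi = w-multi j
      ; γ-multi = multilinear-cong (λ i → ∧-identityʳ (not (Q i))) (multilinear-mix Q (p j) (α-multi A)) }
    adjusted = adjust-∑ A (allFin m) split (ℕ.≤-trans (ℕ.≤-reflexive (length-allFin m)) m≤N)
    A′ = proj₁ adjusted

    w-exchange : ∀ j x → w j (exchange x) ≡ w j x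
    w-exchange j x = local (w-multi j) (exchange x) x (λ i → agree i x)
      where
      agree : ∀ i x → Q i ≡ true → lookup (exchange x) i ≡ lookup x i
      agree (suc (suc i)) (_ ∷ _ ∷ _) eq = refl
    mix-exchange : ∀ q x → mix Q q (exchange x) ≡ exchange (mix Q q x)
    mix-exchange (_ ∷ _ ∷ _) (_ ∷ _ ∷ _) = refl

    new-bundle : Fin m → Bundled< a → Bundled< a
    new-bundle j (t , lt) = let s , le , _ = mixed-bundle M (p j) (w j) (w-multi j) t in
                            s , ℕ.≤-<-trans le lt
    new-cross : Fin m → Crossed n k → Crossed n k
    new-cross j t = proj₁ (mixed-cross M (p j) (w j) (w-multi j) t)
    new-bundles = concatMap (λ j → List.map (new-bundle j) rest) (allFin m)
    new-crosses = concatMap (λ j → List.map (new-cross j) crosses) (allFin m)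

    ∑-new : ∀ x → ∑ᶠ (λ j → w j x *ℙ R (mix Q (p j) x)) ≡
                  ∑ new-bundles (bval x) +ℙ ∑ new-crosses (cval x)
    ∑-new x = begin
      ∑ᶠ (λ j → w j x *ℙ R (mix Q (p j) x))
        ≡⟨ ∑-cong (allFin m) (λ j → trans (ℙ.*-distribˡ-+ (w j x) _ _) (cong₂ _+ℙ_
             (trans (sym (∑-*ˡ rest (w j x) (bval (mix Q (p j) x))))
               (trans (∑-cong rest (λ t → sym (proj₂ (proj₂ (mixed-bundle M (p j) (w j) (w-multi j) (proj₁ t))) x)))
                      (sym (∑-map (new-bundle j) rest (bval x)))))
             (trans (sym (∑-*ˡ crosses (w j x) (cval (mix Q (p j) x))))
               (trans (∑-cong crosses (λ t → sym (proj₂ (mixed-cross M (p j) (w j) (w-multi j) t) x)))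
                      (sym (∑-map (new-cross j) crosses (cval x))))))) ⟩
      ∑ᶠ (λ j → ∑ (List.map (new-bundle j) rest) (bval x) +ℙ ∑ (List.map (new-cross j) crosses) (cval x))
        ≡⟨ ∑-+ (allFin m) (λ j → ∑ (List.map (new-bundle j) rest) (bval x))
                          (λ j → ∑ (List.map (new-cross j) crosses) (cval x)) ⟩
      ∑ᶠ (λ j → ∑ (List.map (new-bundle j) rest) (bval x)) +ℙ
      ∑ᶠ (λ j → ∑ (List.map (new-cross j) crosses) (cval x))
        ≡⟨ sym (cong₂ _+ℙ_ (∑-concatMap (λ j → List.map (new-bundle j) rest) (allFin m) (bval x))
                           (∑-concatMap (λ j → List.map (new-cross j) crosses) (allFin m) (cval x))) ⟩
      ∑ new-bundles (bval x) +ℙ ∑ new-crosses (cval x) ∎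

    τ : Vec (G n) (2 ℕ.+ k) → Parity
    τ x = ∑ᶠ (λ j → w j x *ℙ α A (mix Q (p j) x))

    asymmetry-τ : ∀ x → asymmetry τ x ≡ T x +ℙ (∑ new-bundles (bval x) +ℙ ∑ new-crosses (cval x))
    asymmetry-τ x = begin
      τ x +ℙ τ (exchange x)
        ≡⟨ sym (∑-+ (allFin m) (λ j → w j x *ℙ α A (mix Q (p j) x))
                    (λ j → w j (exchange x) *ℙ α A (mix Q (p j) (exchange x)))) ⟩
      ∑ᶠ (λ j → w j x *ℙ α A (mix Q (p j) x) +ℙ w j (exchange x) *ℙ α A (mix Q (p j) (exchange x)))
        ≡⟨ ∑-cong (allFin m) (λ j → trans
             (cong₂ (λ b y → w j x *ℙ α A (mix Q (p j) x) +ℙ b *ℙ α A y) (w-exchange j x) (mix-exchange (p j) x))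
             (trans (sym (ℙ.*-distribˡ-+ (w j x) _ _))
               (trans (cong (w j x *ℙ_) (trans (bal (mix Q (p j) x))
                                               (ℙ.+-assoc (T (mix Q (p j) x)) _ _)))
                      (ℙ.*-distribˡ-+ (w j x) (T (mix Q (p j) x)) (R (mix Q (p j) x)))))) ⟩
      ∑ᶠ (λ j → w j x *ℙ T (mix Q (p j) x) +ℙ w j x *ℙ R (mix Q (p j) x))
        ≡⟨ ∑-+ (allFin m) (λ j → w j x *ℙ T (mix Q (p j) x)) (λ j → w j x *ℙ R (mix Q (p j) x)) ⟩
      ∑ᶠ (λ j → w j x *ℙ T (mix Q (p j) x)) +ℙ ∑ᶠ (λ j → w j x *ℙ R (mix Q (p j) x))
        ≡⟨ cong₂ _+ℙ_ (sym (T-extracted x)) (∑-new x) ⟩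
      T x +ℙ (∑ new-bundles (bval x) +ℙ ∑ new-crosses (cval x)) ∎

    bal′ : ∀ x → asymmetry (α A′) x ≡
           ∑ (rest ++ new-bundles) (bval x) +ℙ ∑ (crosses ++ new-crosses) (cval x)
    bal′ x = begin
      asymmetry (α A′) x
        ≡⟨ interchange (α A x) (τ x) (α A (exchange x)) (τ (exchange x)) ⟩
      asymmetry (α A) x +ℙ asymmetry τ x
        ≡⟨ cong₂ _+ℙ_ (bal x) (asymmetry-τ x) ⟩
      T x +ℙ ∑ rest (bval x) +ℙ ∑ crosses (cval x) +ℙ (T x +ℙ (∑ new-bundles (bval x) +ℙ ∑ new-crosses (cval x)))
        ≡⟨ solve 5 (λ t r c b d → t :+ r :+ c :+ (t :+ (b :+ d)) := r :+ b :+ (c :+ d)) refl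
             (T x) (∑ rest (bval x)) (∑ crosses (cval x)) (∑ new-bundles (bval x)) (∑ new-crosses (cval x)) ⟩
      ∑ rest (bval x) +ℙ ∑ new-bundles (bval x) +ℙ (∑ crosses (cval x) +ℙ ∑ new-crosses (cval x))
        ≡⟨ sym (cong₂ _+ℙ_ (∑-++ rest new-bundles (bval x)) (∑-++ crosses new-crosses (cval x))) ⟩
      ∑ (rest ++ new-bundles) (bval x) +ℙ ∑ (crosses ++ new-crosses) (cval x) ∎

    enlarged≤ : {C : Set} (xs : List C) (g : Fin m → C → C) → length xs ≤ N →
      length (xs ++ concatMap (λ j → List.map (g j) xs) (allFin m)) ≤ growth N
    enlarged≤ xs g xs≤N = ℕ.≤-trans (ℕ.≤-reflexive (trans (length-++ xs) (cong (length xs ℕ.+_)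
        (trans (length-concatMap (λ j → List.map (g j) xs) (λ j → length-map (g j) xs) (allFin m))
               (cong (ℕ._* length xs) (length-allFin m))))))
      (ℕ.≤-trans (ℕ.+-mono-≤ xs≤N (ℕ.*-mono-≤ m≤N xs≤N)) (N+N²≤growth N))

    result : BundledState a (growth N)
    result = record
      { approx = weaken (2N≤growth N) A′
      ; bundles = rest ++ new-bundles ; crosses = crosses ++ new-crosses
      ; bundles≤ = enlarged≤ rest new-bundle rest≤N ; crosses≤ = enlarged≤ crosses new-cross len′
      ; balance = bal′ }

  -- All tops have code `a`, hence the same set, so the set `M` of the first one serves for all and
  -- `extract` applies to their sum. The products produced come from `rest`, whose codes are below
  -- `a`.
  eliminate-bundles : ∀ {a N} (A : Approximation N)
    (tops : List (Bundled≡ a)) (rest : List (Bundled< a)) (crosses : List (Crossed n k)) →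
    length tops ℕ.+ length rest ≤ N → length crosses ≤ N →
    (∀ x → asymmetry (α A) x ≡ ∑ tops (bval x) +ℙ ∑ rest (bval x) +ℙ ∑ crosses (cval x)) →
    BundledState a (growth N)
  eliminate-bundles {N = N} A [] rest crosses len len′ bal = record
    { approx = weaken (N≤growth N) A ; bundles = rest ; crosses = crosses
    ; bundles≤ = ℕ.≤-trans len (N≤growth N) ; crosses≤ = ℕ.≤-trans len′ (N≤growth N) ; balance = bal }
  eliminate-bundles {a} {N} A tops@((t₀ , code≡a) ∷ _) rest crosses len len′ bal =
      eliminate-extracted A M (Bundled.proper t₀) p w w-multi (λ x → ∑ tops (bval x)) T-extracted
      rest crosses #≤N rest≤N len′ bal
    where
    open Bundled t₀ using (M)
    #tops : ℕ
    #tops = length tops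
    #≤N : #tops ≤ N
    #≤N = ℕ.≤-trans (ℕ.m≤m+n #tops _) len
    rest≤N : length rest ≤ N
    rest≤N = ℕ.≤-trans (ℕ.m≤n+m (length rest) #tops) len
    Q : Fin (2 ℕ.+ k) → Bool
    Q = not ∘ upper M
    top : Fin #tops → Bundled n k
    top l = proj₁ (List.lookup tops l)
    same-M : ∀ l i → upper (Bundled.M (top l)) i ≡ upper M i
    same-M l 0F = refl
    same-M l 1F = refl
    same-M l (suc (suc i)) = code-injective (trans (proj₂ (List.lookup tops l)) (sym code≡a)) i
    extraction = extract Q (λ l → Bundled.h (top l)) (λ l → Bundled.g (top l))
      (λ l → multilinear-cong (λ i → trans (same-M l i) (sym (not-involutive (upper M i)))) (Bundled.h-multi (top l)))
      (λ l → multilinear-cong (λ i → cong not (same-M l i)) (Bundled.g-multi (top l)))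
    p = proj₁ extraction
    w = proj₁ (proj₂ extraction)
    w-multi : ∀ j → Multilinear Q (w j)
    w-multi j = multilinear-span
      (λ l → multilinear-cong (λ i → cong not (same-M l i)) (Bundled.g-multi (top l)))
      (proj₁ (proj₂ (proj₂ extraction)) j)
    T-extracted : ∀ x → ∑ tops (bval x) ≡ ∑ᶠ (λ j → w j x *ℙ ∑ tops (bval (mix Q (p j) x)))
    T-extracted x = trans (sym (∑ᶠ-lookup tops (bval x)))
      (trans (proj₂ (proj₂ (proj₂ extraction)) x)
             (∑-cong (allFin #tops) (λ j → cong (w j x *ℙ_) (∑ᶠ-lookup tops (bval (mix Q (p j) x))))))

  top? : ∀ {a} (t : Bundled< (suc a)) → Σ[ s ∈ Bundled≡ a ⊎ Bundled< a ] (∀ x → bval x t ≡ [ bval x , bval x ]′ s)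
  top? (t , lt) with ℕ.m<1+n⇒m<n∨m≡n lt
  ... | inj₁ lt′ = inj₂ (t , lt′) , λ _ → refl
  ... | inj₂ eq  = inj₁ (t , eq) , λ _ → refl

  bundled-step : ∀ {a N} → BundledState (suc a) N → BundledState a (growth N)
  bundled-step state = eliminate-bundles approx lefts rights crosses
      (ℕ.≤-trans (ℕ.≤-reflexive lengths) bundles≤) crosses≤
      (λ x → trans (balance x) (cong (_+ℙ ∑ crosses (cval x))
        (trans (∑-cong bundles (λ t → proj₂ (top? t) x)) (∑-separate (bval x) (bval x)))))
    where
    open BundledState state
    open Separation (separate (λ t → proj₁ (top? t)) bundles)

-- Removal of the crossed products

recolour : Bool → Colour → Colour → Colour
recolour true  κ μ = if isX κ then X else Z
recolour false κ μ = μ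

-- The substitution leaves `t` only `x` and the class `X` of `c₀`, which `s` has in common. There
-- `f` of `t` keeps its own `X` variables, and what survives of its `g` and `h` is absorbed into the
-- new `h`, whence colour `Z`. Off that class the colours are those of `s`. So the new `X` lies in
-- that of `t` and the new `Y` in that of `s`.
mixed-product : (c₀ : Fin k → Colour) (p : Vec (G n) (2 ℕ.+ k)) (a : Parity) (s t : Crossed n k) →
  (∀ i → isX (Crossed.c s i) ≡ isX (c₀ i)) →
  let Q = not ∘ isX ∘ colour c₀ in
  Σ[ r ∈ Crossed n k ] (Crossed.codeX r ≤ Crossed.codeX t × Crossed.codeY r ≤ Crossed.codeY s ×
    (∀ x → Crossed.value r x ≡
           a *ℙ (Crossed.g s x *ℙ Crossed.h s x) *ℙ Crossed.value t (mix Q p x)))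
mixed-product {k} c₀ p a s t same-X = record
    { c = c ; f = λ x → T.f (mix Q p x) ; g = S.g
    ; h = λ x → a *ℙ (S.h x *ℙ (T.g (mix Q p x) *ℙ T.h (mix Q p x)))
    ; f-multi = multilinear-cong X-support (multilinear-mix Q p T.f-multi)
    ; g-multi = multilinear-cong Y-support S.g-multi
    ; h-multi = λ i → at-*ˡ a (at-* (Z-support i) (S.h-multi i) (multilinear-mix Q p T.gh-multi i)) } ,
  code-mono (λ i → X⇒X (isX (c₀ i)) (T.c i) (S.c i) (same-X i)) ,
  code-mono (λ i → Y⇒Y (isX (c₀ i)) (T.c i) (S.c i)) ,
  λ x → solve 6 (λ a g h f′ g′ h′ → f′ :* (g :* (a :* (h :* (g′ :* h′)))) := a :* (g :* h) :* (f′ :* (g′ :* h′))) refl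
          a (S.g x) (S.h x) (T.f (mix Q p x)) (T.g (mix Q p x)) (T.h (mix Q p x))
  where
  module S = Crossed s
  module T = Crossed t
  Q : Fin (2 ℕ.+ k) → Bool
  Q = not ∘ isX ∘ colour c₀
  c : Fin k → Colour
  c i = recolour (isX (c₀ i)) (T.c i) (S.c i)
  X⇒X : ∀ b κ μ → isX μ ≡ b → isX (recolour b κ μ) ≡ true → isX κ ≡ true
  X⇒X true  X μ _  _  = refl
  X⇒X false κ X () _
  Y⇒Y : ∀ b κ μ → isY (recolour b κ μ) ≡ true → isY μ ≡ true
  Y⇒Y true X _ ()
  Y⇒Y true Y _ ()
  Y⇒Y true Z _ ()
  Y⇒Y false κ μ eq = eq
  X-support : ∀ i → not (Q i) ∧ isX (colour T.c i) ≡ isX (colour c i)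
  X-support 0F = refl
  X-support 1F = refl
  X-support (suc (suc i)) = go (isX (c₀ i)) (T.c i) (S.c i) (same-X i)
    where
    go : ∀ b κ μ → isX μ ≡ b → not (not b) ∧ isX κ ≡ isX (recolour b κ μ)
    go true  X μ _  = refl
    go true  Y μ _  = refl
    go true  Z μ _  = refl
    go false κ μ eq = sym eq
  Y-support : ∀ i → isY (colour S.c i) ≡ isY (colour c i)
  Y-support 0F = refl
  Y-support 1F = refl
  Y-support (suc (suc i)) = go (isX (c₀ i)) (T.c i) (S.c i) (same-X i)
    where
    go : ∀ b κ μ → isX μ ≡ b → isY μ ≡ isY (recolour b κ μ)
    go true  X X _ = refl
    go true  Y X _ = refl
    go true  Z X _ = refl
    go false κ μ _ = refl
  Z-support : ∀ i → Disjoint (isZ (colour S.c i)) (not (Q i) ∧ not (isX (colour T.c i))) (isZ (colour c i))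
  Z-support 0F = neither
  Z-support 1F = neither
  Z-support (suc (suc i)) = go (isX (c₀ i)) (T.c i) (S.c i) (same-X i)
    where
    go : ∀ b κ μ → isX μ ≡ b → Disjoint (isZ μ) (not (not b) ∧ not (isX κ)) (isZ (recolour b κ μ))
    go true  X X _ = neither
    go true  Y X _ = right
    go true  Z X _ = right
    go false κ Y _ = neither
    go false κ Z _ = left

module CrossedReduction {n k : ℕ} (α₀ : Vec (G n) (2 ℕ.+ k) → Parity) where
  open Reduction α₀

  Crossed< Crossed≡ˣ Crossed≡ʸ : ℕ → Set
  Crossed<  a = Σ[ t ∈ Crossed n k ] (Crossed.codeX t ℕ.< a × Crossed.codeY t ℕ.< a)
  Crossed≡ˣ a = Σ[ t ∈ Crossed n k ] (Crossed.codeX t ≡ a × Crossed.codeY t ℕ.< a)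
  Crossed≡ʸ a = Σ[ t ∈ Crossed n k ] (Crossed.codeX t ℕ.< a × Crossed.codeY t ≡ a)

  val : {P : Crossed n k → Set} → Vec (G n) (2 ℕ.+ k) → Σ (Crossed n k) P → Parity
  val x (t , _) = Crossed.value t x

  record CrossedState (a N : ℕ) : Set where
    field
      approx   : Approximation N
      crosses  : List (Crossed< a)
      crosses≤ : length crosses ≤ N
      balance  : ∀ x → asymmetry (α approx) x ≡ ∑ crosses (val x)

  record OrientedState (a N : ℕ) : Set where
    field
      approx   : Approximation N
      tops     : List (Crossed≡ˣ a)
      rest     : List (Crossed< a)
      crosses≤ : length tops ℕ.+ length rest ≤ N
      balance  : ∀ x → asymmetry (α approx) x ≡ ∑ tops (val x) +ℙ ∑ rest (val x)

  -- Equal codes mean equal classes, and disjoint equal classes are empty, with code 0.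
  not-both-maximal : ∀ (t : Crossed n k) → Crossed.codeX t ≡ suc m → Crossed.codeY t ≢ suc m
  not-both-maximal t eqX eqY = contradiction
    (trans (sym eqX) (trans (code-cong (λ i → not-X (c i) (code-injective (trans eqX (sym eqY)) i))) (code-∅ k))) λ ()
    where
    open Crossed t
    not-X : ∀ κ → isX κ ≡ isY κ → isX κ ≡ false
    not-X Z _ = refl

  rank : (t : Crossed< (2 ℕ.+ m)) → Σ[ s ∈ Crossed≡ʸ (suc m) ⊎ (Crossed≡ˣ (suc m) ⊎ Crossed< (suc m)) ]
         (∀ x → val x t ≡ [ val x , [ val x , val x ]′ ]′ s)
  rank (t , ltX , ltY) with ℕ.m<1+n⇒m<n∨m≡n ltX | ℕ.m<1+n⇒m<n∨m≡n ltY
  ... | inj₁ ltX′ | inj₁ ltY′ = inj₂ (inj₂ (t , ltX′ , ltY′)) , λ _ → refl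
  ... | inj₂ eqX  | inj₁ ltY′ = inj₂ (inj₁ (t , eqX , ltY′)) , λ _ → refl
  ... | inj₁ ltX′ | inj₂ eqY  = inj₁ (t , ltX′ , eqY) , λ _ → refl
  ... | inj₂ eqX  | inj₂ eqY  = contradiction eqY (not-both-maximal t eqX)

  turn : Crossed≡ʸ m → Crossed≡ˣ m
  turn (t , ltX , eqY) = transposed t , trans (transposed-codeX t) eqY , subst (ℕ._< _) (sym (transposed-codeY t)) ltX

  -- Adding a product to `α` adds it and its transpose to the asymmetry. For products present there
  -- with maximal `Y`, the first cancels and the second, with maximal `X`, takes its place, so the
  -- number of products does not change.
  orient : ∀ {a N} → CrossedState (2 ℕ.+ a) N → OrientedState (suc a) (growth N)
  orient {a} {N} state = record
    { approx = weaken (2N≤growth N) A′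
    ; tops = A.lefts ++ List.map turn B.lefts ; rest = A.rights
    ; crosses≤ = ℕ.≤-trans (ℕ.≤-reflexive count) (ℕ.≤-trans crosses≤ (N≤growth N))
    ; balance = bal }
    where
    open CrossedState state
    module B = Separation (separate (λ t → proj₁ (rank t)) crosses)
    module A = Separation (separate id B.rights)
    adjusted = adjust-∑ approx B.lefts (λ t → Crossed.toSplit (proj₁ t))
      (ℕ.≤-trans (ℕ.m≤m+n (length B.lefts) _) (ℕ.≤-trans (ℕ.≤-reflexive B.lengths) crosses≤))
    A′ = proj₁ adjusted
    count : length (A.lefts ++ List.map turn B.lefts) ℕ.+ length A.rights ≡ length crosses
    count = begin
      length (A.lefts ++ List.map turn B.lefts) ℕ.+ length A.rights
        ≡⟨ cong (ℕ._+ length A.rights) (trans (length-++ A.lefts) (cong (length A.lefts ℕ.+_) (length-map turn B.lefts))) ⟩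
      length A.lefts ℕ.+ length B.lefts ℕ.+ length A.rights
        ≡⟨ cong (ℕ._+ length A.rights) (ℕ.+-comm (length A.lefts) (length B.lefts)) ⟩
      length B.lefts ℕ.+ length A.lefts ℕ.+ length A.rights
        ≡⟨ ℕ.+-assoc (length B.lefts) (length A.lefts) (length A.rights) ⟩
      length B.lefts ℕ.+ (length A.lefts ℕ.+ length A.rights)
        ≡⟨ cong (length B.lefts ℕ.+_) A.lengths ⟩
      length B.lefts ℕ.+ length B.rights
        ≡⟨ B.lengths ⟩
      length crosses ∎
    separated : ∀ x → ∑ crosses (val x) ≡ ∑ B.lefts (val x) +ℙ (∑ A.lefts (val x) +ℙ ∑ A.rights (val x))
    separated x = trans (∑-cong crosses (λ t → proj₂ (rank t) x))
      (trans (B.∑-separate (val x) [ val x , val x ]′)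
             (cong (∑ B.lefts (val x) +ℙ_) (A.∑-separate (val x) (val x))))
    turned : ∀ x → ∑ (List.map turn B.lefts) (val x) ≡ ∑ B.lefts (val (exchange x))
    turned x = trans (∑-map turn B.lefts (val x)) (∑-cong B.lefts (λ t → transposed-value (proj₁ t) x))
    bal : ∀ x → asymmetry (α A′) x ≡ ∑ (A.lefts ++ List.map turn B.lefts) (val x) +ℙ ∑ A.rights (val x)
    bal x = begin
      asymmetry (α A′) x
        ≡⟨ interchange (α approx x) (∑ B.lefts (val x)) (α approx (exchange x)) (∑ B.lefts (val (exchange x))) ⟩
      asymmetry (α approx) x +ℙ (∑ B.lefts (val x) +ℙ ∑ B.lefts (val (exchange x)))
        ≡⟨ cong₂ (λ a b → a +ℙ (∑ B.lefts (val x) +ℙ b)) (trans (balance x) (separated x)) (sym (turned x)) ⟩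
      ∑ B.lefts (val x) +ℙ (∑ A.lefts (val x) +ℙ ∑ A.rights (val x)) +ℙ
        (∑ B.lefts (val x) +ℙ ∑ (List.map turn B.lefts) (val x))
        ≡⟨ solve 4 (λ y l r u → y :+ (l :+ r) :+ (y :+ u) := l :+ u :+ r) refl
             (∑ B.lefts (val x)) (∑ A.lefts (val x)) (∑ A.rights (val x)) (∑ (List.map turn B.lefts) (val x)) ⟩
      ∑ A.lefts (val x) +ℙ ∑ (List.map turn B.lefts) (val x) +ℙ ∑ A.rights (val x)
        ≡⟨ cong (_+ℙ ∑ A.rights (val x)) (sym (∑-++ A.lefts (List.map turn B.lefts) (val x))) ⟩
      ∑ (A.lefts ++ List.map turn B.lefts) (val x) +ℙ ∑ A.rights (val x) ∎

  X< : ℕ → Set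
  X< a = Σ[ t ∈ Crossed n k ] Crossed.codeX t ℕ.< a

  -- Tops agree on the colour class X; their g h factors are expanded by
  -- interpolation, and the values of their sum on the interpolation points are
  -- read off from the asymmetry with its first two arguments exchanged.
  eliminate-expanded : ∀ {a m N} (A : Approximation N) (c₀ : Fin k → Colour) (top : Fin m → Crossed n k) →
    (∀ l → Crossed.codeY (top l) ℕ.< a) → (∀ l i → isX (Crossed.c (top l) i) ≡ isX (c₀ i)) →
    let Q = not ∘ isX ∘ colour c₀ in
    (p : Fin m → Vec (G n) (2 ℕ.+ k)) (c : Fin m → Fin m → Parity) (T : Vec (G n) (2 ℕ.+ k) → Parity) →
    (∀ x → T x ≡ ∑ᶠ (λ j → ∑ᶠ (λ l → c j l *ℙ (Crossed.g (top l) x *ℙ Crossed.h (top l) x)) *ℙ T (mix Q (p j) x))) →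
    (others : List (X< a)) → (∀ x → T x ≡ ∑ others (val x)) →
    (rest : List (Crossed< a)) → m ≤ N → length others ≤ N ℕ.+ N → length rest ≤ N →
    (∀ x → asymmetry (α A) x ≡ T x +ℙ ∑ rest (val x)) →
    CrossedState a (growth N)
  eliminate-expanded {a} {m} {N} A c₀ top codeY< same-X p c T expanded others T≡ rest m≤N others≤ rest≤N bal = record
    { approx = weaken (N≤growth N) A ; crosses = rest ++ new
    ; crosses≤ = ℕ.≤-trans (ℕ.≤-reflexive (trans (length-++ rest) (cong (length rest ℕ.+_) new-length)))
        (ℕ.≤-trans (ℕ.+-mono-≤ rest≤N (ℕ.*-mono-≤ m≤N (ℕ.*-mono-≤ m≤N others≤))) (N+2N³≤growth N))
    ; balance = λ x → trans (bal x) (trans (ℙ.+-comm (T x) _)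
        (trans (cong (∑ rest (val x) +ℙ_) (T≡new x)) (sym (∑-++ rest new (val x))))) }
    where
    Q : Fin (2 ℕ.+ k) → Bool
    Q = not ∘ isX ∘ colour c₀
    product : ∀ j l (t : X< a) → _
    product j l t = mixed-product c₀ (p j) (c j l) (top l) (proj₁ t) (same-X l)
    make : Fin m → Fin m → X< a → Crossed< a
    make j l t = let r , leX , leY , _ = product j l t in
                 r , ℕ.≤-<-trans leX (proj₂ t) , ℕ.≤-<-trans leY (codeY< l)
    row : Fin m → List (Crossed< a)
    row j = concatMap (λ l → List.map (make j l) others) (allFin m)
    new : List (Crossed< a)
    new = concatMap row (allFin m)
    row-length : ∀ j → length (row j) ≡ m ℕ.* length others
    row-length j = trans (length-concatMap (λ l → List.map (make j l) others) (λ l → length-map (make j l) others) (allFin m))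
                         (cong (ℕ._* length others) (length-allFin m))
    new-length : length new ≡ m ℕ.* (m ℕ.* length others)
    new-length = trans (length-concatMap row row-length (allFin m)) (cong (ℕ._* (m ℕ.* length others)) (length-allFin m))
    gh : Fin m → Vec (G n) (2 ℕ.+ k) → Parity
    gh l x = Crossed.g (top l) x *ℙ Crossed.h (top l) x
    T≡new : ∀ x → T x ≡ ∑ new (val x)
    T≡new x = begin
      T x
        ≡⟨ expanded x ⟩
      ∑ᶠ (λ j → ∑ᶠ (λ l → c j l *ℙ gh l x) *ℙ T (mix Q (p j) x))
        ≡⟨ ∑-cong (allFin m) (λ j → sym (∑-*ʳ (allFin m) (λ l → c j l *ℙ gh l x) (T (mix Q (p j) x)))) ⟩
      ∑ᶠ (λ j → ∑ᶠ (λ l → c j l *ℙ gh l x *ℙ T (mix Q (p j) x)))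
        ≡⟨ ∑-cong (allFin m) (λ j → ∑-cong (allFin m) (λ l →
             trans (cong (c j l *ℙ gh l x *ℙ_) (T≡ (mix Q (p j) x)))
               (trans (sym (∑-*ˡ others (c j l *ℙ gh l x) (val (mix Q (p j) x))))
                 (trans (∑-cong others (λ t → sym (proj₂ (proj₂ (proj₂ (product j l t))) x)))
                        (sym (∑-map (make j l) others (val x))))))) ⟩
      ∑ᶠ (λ j → ∑ᶠ (λ l → ∑ (List.map (make j l) others) (val x)))
        ≡⟨ ∑-cong (allFin m) (λ j → sym (∑-concatMap (λ l → List.map (make j l) others) (allFin m) (val x))) ⟩
      ∑ᶠ (λ j → ∑ (row j) (val x))
        ≡⟨ sym (∑-concatMap row (allFin m) (val x)) ⟩
      ∑ new (val x) ∎

  -- `Q` contains `y` but not `x`, so slices of `α` do not help and `α` is left as it is: the tops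
  -- are rewritten as products with smaller classes. Here `f` is the free factor and `g h` the
  -- interpolated one, so that each new product inherits its `Y` from a top.
  eliminate-crosses : ∀ {a N} (A : Approximation N) (tops : List (Crossed≡ˣ a)) (rest : List (Crossed< a)) →
    length tops ℕ.+ length rest ≤ N →
    (∀ x → asymmetry (α A) x ≡ ∑ tops (val x) +ℙ ∑ rest (val x)) →
    CrossedState a (growth N)
  eliminate-crosses {N = N} A [] rest len bal = record
    { approx = weaken (N≤growth N) A ; crosses = rest ; crosses≤ = ℕ.≤-trans len (N≤growth N) ; balance = bal }
  eliminate-crosses {a} {N} A tops@((t₀ , code≡a , _) ∷ _) rest len bal =
    eliminate-expanded A c₀ top (λ l → proj₂ (proj₂ (List.lookup tops l))) same-X p
      (λ j → Span.coeff (w-span j)) (λ x → ∑ tops (val x))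
      T-expanded others T≡others rest
      (ℕ.≤-trans (ℕ.m≤m+n #tops _) len) others≤ rest≤N bal
    where
    c₀ = Crossed.c t₀
    #tops : ℕ
    #tops = length tops
    rest≤N : length rest ≤ N
    rest≤N = ℕ.≤-trans (ℕ.m≤n+m (length rest) #tops) len
    Q : Fin (2 ℕ.+ k) → Bool
    Q = not ∘ isX ∘ colour c₀
    top : Fin #tops → Crossed n k
    top l = proj₁ (List.lookup tops l)
    same-X : ∀ l i → isX (Crossed.c (top l) i) ≡ isX (c₀ i)
    same-X l = code-injective (trans (proj₁ (proj₂ (List.lookup tops l))) (sym code≡a))
    same : ∀ l i → isX (colour (Crossed.c (top l)) i) ≡ isX (colour c₀ i)
    same l 0F = refl
    same l 1F = refl
    same l (suc (suc i)) = same-X l i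
    gh : Fin #tops → Vec (G n) (2 ℕ.+ k) → Parity
    gh l x = Crossed.g (top l) x *ℙ Crossed.h (top l) x
    extraction = extract Q (λ l → Crossed.f (top l)) gh
      (λ l → multilinear-cong (λ i → trans (same l i) (sym (not-involutive (isX (colour c₀ i))))) (Crossed.f-multi (top l)))
      (λ l → multilinear-cong (λ i → cong not (same l i)) (Crossed.gh-multi (top l)))
    p = proj₁ extraction
    w = proj₁ (proj₂ extraction)
    w-span : ∀ j → Span gh (w j)
    w-span = proj₁ (proj₂ (proj₂ extraction))
    T-expanded : ∀ x → ∑ tops (val x) ≡
      ∑ᶠ (λ j → ∑ᶠ (λ l → Span.coeff (w-span j) l *ℙ gh l x) *ℙ ∑ tops (val (mix Q (p j) x)))
    T-expanded x = trans (sym (∑ᶠ-lookup tops (val x)))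
      (trans (proj₂ (proj₂ (proj₂ extraction)) x)
             (∑-cong (allFin #tops) (λ j → cong₂ _*ℙ_ (Span.expands (w-span j) x)
                                                      (∑ᶠ-lookup tops (val (mix Q (p j) x))))))
    -- Orientation enters here: the `X` of the transpose is the `Y` of the top, of code strictly
    -- below `a`.
    turn-top : Crossed≡ˣ a → X< a
    turn-top (t , _ , ltY) = transposed t , subst (ℕ._< a) (sym (transposed-codeX t)) ltY
    turn-rest : Crossed< a → X< a
    turn-rest (t , _ , ltY) = transposed t , subst (ℕ._< a) (sym (transposed-codeX t)) ltY
    keep-rest : Crossed< a → X< a
    keep-rest (t , ltX , _) = t , ltX
    others : List (X< a)
    others = List.map turn-top tops ++ List.map turn-rest rest ++ List.map keep-rest rest
    others≤ : length others ≤ N ℕ.+ N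
    others≤ = ℕ.≤-trans (ℕ.≤-reflexive (begin
      length others
        ≡⟨ length-++ (List.map turn-top tops) ⟩
      length (List.map turn-top tops) ℕ.+ length (List.map turn-rest rest ++ List.map keep-rest rest)
        ≡⟨ cong₂ ℕ._+_ (length-map turn-top tops) (trans (length-++ (List.map turn-rest rest))
             (cong₂ ℕ._+_ (length-map turn-rest rest) (length-map keep-rest rest))) ⟩
      #tops ℕ.+ (length rest ℕ.+ length rest)
        ≡⟨ sym (ℕ.+-assoc #tops (length rest) (length rest)) ⟩
      #tops ℕ.+ length rest ℕ.+ length rest ∎))
      (ℕ.+-mono-≤ len rest≤N)
    -- Tops plus `rest` equal the asymmetry, which is invariant under `exchange`; hence the tops are
    -- the exchanged tops, the exchanged `rest` and `rest` together, and all of these have `X` of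
    -- code below `a`.
    T≡others : ∀ x → ∑ tops (val x) ≡ ∑ others (val x)
    T≡others x = begin
      ∑ tops (val x)
        ≡⟨ solve 2 (λ t r → t := t :+ r :+ r) refl (∑ tops (val x)) (∑ rest (val x)) ⟩
      ∑ tops (val x) +ℙ ∑ rest (val x) +ℙ ∑ rest (val x)
        ≡⟨ cong (_+ℙ ∑ rest (val x)) (trans (sym (bal x))
             (trans (sym (asymmetry-exchange (α A) x)) (bal (exchange x)))) ⟩
      ∑ tops (val (exchange x)) +ℙ ∑ rest (val (exchange x)) +ℙ ∑ rest (val x)
        ≡⟨ ℙ.+-assoc (∑ tops (val (exchange x))) _ _ ⟩
      ∑ tops (val (exchange x)) +ℙ (∑ rest (val (exchange x)) +ℙ ∑ rest (val x))
        ≡⟨ sym (cong₂ _+ℙ_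
             (trans (∑-map turn-top tops (val x)) (∑-cong tops (λ t → transposed-value (proj₁ t) x)))
             (trans (∑-++ (List.map turn-rest rest) (List.map keep-rest rest) (val x)) (cong₂ _+ℙ_
               (trans (∑-map turn-rest rest (val x)) (∑-cong rest (λ t → transposed-value (proj₁ t) x)))
               (∑-map keep-rest rest (val x))))) ⟩
      ∑ (List.map turn-top tops) (val x) +ℙ ∑ (List.map turn-rest rest ++ List.map keep-rest rest) (val x)
        ≡⟨ sym (∑-++ (List.map turn-top tops) _ (val x)) ⟩
      ∑ others (val x) ∎

  crossed-step : ∀ {a N} → OrientedState a N → CrossedState a (growth N)
  crossed-step state = eliminate-crosses approx tops rest crosses≤ balance
    where open OrientedState state

-- Symmetrisation with empty colour classes

first firstTwo : Fin (2 ℕ.+ k) → Bool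
first zero             = true
first (suc _)          = false
firstTwo 0F            = true
firstTwo 1F            = true
firstTwo (suc (suc _)) = false

mix-none : ∀ (p x : Vec A k) → mix (λ _ → false) p x ≡ x
mix-none []      []      = refl
mix-none (p ∷ ps) (x ∷ xs) = cong (x ∷_) (mix-none ps xs)

mix-first : ∀ (p : Vec A (2 ℕ.+ k)) x y z → mix first p (x ∷ y ∷ z) ≡ head p ∷ y ∷ z
mix-first (p ∷ _ ∷ ps) x y z = cong (λ v → p ∷ y ∷ v) (mix-none ps z)

-- The strict order as a 0/1 weight, selecting one of the pairs `(l , j)` and `(j , l)` whenever the
-- two indices differ.
below : Fin m → Fin m → Parity
below zero    zero    = 0ℙ
below zero    (suc _) = 1ℙ
below (suc _) zero    = 0ℙ
below (suc i) (suc j) = below i j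

below-total : ∀ (i j : Fin m) → i ≡ j ⊎ below i j +ℙ below j i ≡ 1ℙ
below-total zero    zero    = inj₁ refl
below-total zero    (suc _) = inj₂ refl
below-total (suc _) zero    = inj₂ refl
below-total (suc i) (suc j) with below-total i j
... | inj₁ i≡j = inj₁ (cong suc i≡j)
... | inj₂ eq  = inj₂ eq

multilinear-asymmetry : {φ : Vec (G n) (2 ℕ.+ k) → Parity} → Multilinear everywhere φ → Multilinear everywhere (asymmetry φ)
multilinear-asymmetry ml i = at-+ (ml i) (at-exchange (ml (exchangeᶠ i)))

-- The asymmetry is alternating, not just symmetric; a diagonal term, being its own exchange, could
-- not be split into a half and its mirror image.
asymmetry-diagonal : ∀ (φ : Vec (G n) (2 ℕ.+ k) → Parity) q z → asymmetry φ (q ∷ q ∷ z) ≡ 0ℙ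
asymmetry-diagonal φ q z = ℙ.p+p≡0ℙ (φ (q ∷ q ∷ z))

module Conclusion {n k : ℕ} (α₀ : Vec (G n) (2 ℕ.+ k) → Parity) where
  open Reduction α₀
  open CrossedReduction α₀

  Symmetrised : ℕ → Set
  Symmetrised N = Σ[ A ∈ Approximation N ] (∀ x → asymmetry (α A) x ≡ 0ℙ)

  -- Expanding both arguments, asymmetry = ∑ⱼₗ w_j(x) w_l(y) d_lj(z) with d
  -- symmetric and zero on the diagonal, so half of the sum symmetrises α.
  symmetrise-expanded : ∀ {m N} (A : Approximation N) (p : Fin m → Vec (G n) (2 ℕ.+ k))
    (w : Fin m → Vec (G n) (2 ℕ.+ k) → Parity) → (∀ j → Multilinear first (w j)) → m ≤ N →
    (∀ x → asymmetry (α A) x ≡ ∑ᶠ (λ j → w j x *ℙ asymmetry (α A) (mix first (p j) x))) →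
    Symmetrised (growth N)
  symmetrise-expanded {m} {N} A p w w-multi m≤N expanded = weaken (2N≤growth N) A′ , vanishes
    where
    D : Vec (G n) (2 ℕ.+ k) → Parity
    D = asymmetry (α A)
    q : Fin m → G n
    q j = head (p j)
    -- A filler: `firstTwo` leaves the remaining variables free, so these coordinates are never
    -- read.
    origin : Vec (G n) k
    origin = replicate k (replicate n 0ℙ)
    δ : Fin m → Fin m → Vec (G n) (2 ℕ.+ k) → Parity
    δ l j x = D (mix firstTwo (q l ∷ q j ∷ origin) x)
    δ-value : ∀ l j x y z → δ l j (x ∷ y ∷ z) ≡ D (q l ∷ q j ∷ z)
    δ-value l j x y z = cong (λ v → D (q l ∷ q j ∷ v)) (mix-none origin z)
    w-first : ∀ j x y z y′ z′ → w j (x ∷ y ∷ z) ≡ w j (x ∷ y′ ∷ z′)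
    w-first j x y z y′ z′ = local (w-multi j) (x ∷ y ∷ z) (x ∷ y′ ∷ z′) agree
      where
      agree : ∀ (i : Fin (2 ℕ.+ k)) → first i ≡ true → lookup (x ∷ y ∷ z) i ≡ lookup (x ∷ y′ ∷ z′) i
      agree zero _ = refl
    -- By symmetry of `D` the argument `y` is moved to the front, where `expanded` applies a second
    -- time.
    second-expanded : ∀ j x → D (mix first (p j) x) ≡ ∑ᶠ (λ l → w l (exchange x) *ℙ δ l j x)
    second-expanded j (x ∷ y ∷ z) = begin
      D (mix first (p j) (x ∷ y ∷ z))
        ≡⟨ cong D (mix-first (p j) x y z) ⟩
      D (q j ∷ y ∷ z)
        ≡⟨ sym (asymmetry-exchange (α A) (q j ∷ y ∷ z)) ⟩
      D (y ∷ q j ∷ z)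
        ≡⟨ expanded (y ∷ q j ∷ z) ⟩
      ∑ᶠ (λ l → w l (y ∷ q j ∷ z) *ℙ D (mix first (p l) (y ∷ q j ∷ z)))
        ≡⟨ ∑-cong (allFin m) (λ l → cong₂ _*ℙ_ (w-first l y (q j) z x z)
             (trans (cong D (mix-first (p l) y (q j) z)) (sym (δ-value l j x y z)))) ⟩
      ∑ᶠ (λ l → w l (y ∷ x ∷ z) *ℙ δ l j (x ∷ y ∷ z)) ∎
    δ-exchange : ∀ l j x → δ l j (exchange x) ≡ δ j l x
    δ-exchange l j (x ∷ y ∷ z) = trans (δ-value l j y x z)
      (trans (asymmetry-exchange (α A) (q j ∷ q l ∷ z)) (sym (δ-value j l x y z)))
    δ-diagonal : ∀ j x → δ j j x ≡ 0ℙ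
    δ-diagonal j (x ∷ y ∷ z) = trans (δ-value j j x y z) (asymmetry-diagonal (α A) (q j) z)
    halves : ∀ l j x → (below l j +ℙ below j l) *ℙ δ l j x ≡ δ l j x
    halves l j x with below-total l j
    ... | inj₁ refl = trans (cong ((below l l +ℙ below l l) *ℙ_) (δ-diagonal l x))
                            (trans (ℙ.*-zeroʳ (below l l +ℙ below l l)) (sym (δ-diagonal l x)))
    ... | inj₂ eq   = cong (_*ℙ δ l j x) eq

    half : Fin m → Vec (G n) (2 ℕ.+ k) → Parity
    half j x = ∑ᶠ (λ l → below l j *ℙ (w l (exchange x) *ℙ δ l j x))
    -- `half j` does not involve `x`, so the double sum, grouped by `j`, costs only `m` products.
    split : Fin m → Split n (2 ℕ.+ k)
    split j = record
      { P = first ; in₀ = 0F , refl ; out₀ = 1F , refl ; β = w j ; γ = half j ; β-multi = w-multi j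
      ; γ-multi = λ i → at-∑ (allFin m) (λ l → at-*ˡ (below l j) (at-* (disjoint i)
          (at-exchange (w-multi l (exchangeᶠ i)))
          (multilinear-mix firstTwo (q l ∷ q j ∷ origin) (multilinear-asymmetry (α-multi A)) i))) }
      where
      disjoint : ∀ i → Disjoint (first (exchangeᶠ i)) (not (firstTwo i) ∧ true) (not (first i))
      disjoint 0F            = neither
      disjoint 1F            = left
      disjoint (suc (suc i)) = right
    adjusted = adjust-∑ A (allFin m) split (ℕ.≤-trans (ℕ.≤-reflexive (length-allFin m)) m≤N)
    A′ = proj₁ adjusted
    τ : Vec (G n) (2 ℕ.+ k) → Parity
    τ x = ∑ᶠ (λ j → w j x *ℙ half j x)
    term : Fin m → Fin m → Vec (G n) (2 ℕ.+ k) → Parity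
    term j l x = w j x *ℙ (w l (exchange x) *ℙ δ l j x)
    τ-direct : ∀ x → τ x ≡ ∑ᶠ (λ j → ∑ᶠ (λ l → below l j *ℙ term j l x))
    τ-direct x = ∑-cong (allFin m) (λ j → trans (sym (∑-*ˡ (allFin m) (w j x) _))
      (∑-cong (allFin m) (λ l → solve 3 (λ a b c → a :* (b :* c) := b :* (a :* c)) refl
        (w j x) (below l j) (w l (exchange x) *ℙ δ l j x))))
    -- Exchanging `x` and `y` amounts to swapping the two indices, so relabelling gives the same
    -- terms with the opposite weight.
    τ-exchanged : ∀ x → τ (exchange x) ≡ ∑ᶠ (λ j → ∑ᶠ (λ l → below j l *ℙ term j l x))
    τ-exchanged x = begin
      τ (exchange x)
        ≡⟨ τ-direct (exchange x) ⟩
      ∑ᶠ (λ l → ∑ᶠ (λ j → below j l *ℙ (w l (exchange x) *ℙ (w j (exchange (exchange x)) *ℙ δ j l (exchange x)))))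
        ≡⟨ ∑-swap (allFin m) (allFin m) _ ⟩
      ∑ᶠ (λ j → ∑ᶠ (λ l → below j l *ℙ (w l (exchange x) *ℙ (w j (exchange (exchange x)) *ℙ δ j l (exchange x)))))
        ≡⟨ ∑-cong (allFin m) (λ j → ∑-cong (allFin m) (λ l → cong (below j l *ℙ_)
             (trans (cong₂ (λ y d → w l (exchange x) *ℙ (w j y *ℙ d)) (exchange-involutive x) (δ-exchange j l x))
                    (solve 3 (λ a b c → a :* (b :* c) := b :* (a :* c)) refl
                       (w l (exchange x)) (w j x) (δ l j x))))) ⟩
      ∑ᶠ (λ j → ∑ᶠ (λ l → below j l *ℙ term j l x)) ∎
    asymmetry-τ : ∀ x → asymmetry τ x ≡ D x
    asymmetry-τ x = begin
      τ x +ℙ τ (exchange x)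
        ≡⟨ cong₂ _+ℙ_ (τ-direct x) (τ-exchanged x) ⟩
      ∑ᶠ (λ j → ∑ᶠ (λ l → below l j *ℙ term j l x)) +ℙ ∑ᶠ (λ j → ∑ᶠ (λ l → below j l *ℙ term j l x))
        ≡⟨ sym (∑-+ (allFin m) (λ j → ∑ᶠ (λ l → below l j *ℙ term j l x)) (λ j → ∑ᶠ (λ l → below j l *ℙ term j l x))) ⟩
      ∑ᶠ (λ j → ∑ᶠ (λ l → below l j *ℙ term j l x) +ℙ ∑ᶠ (λ l → below j l *ℙ term j l x))
        ≡⟨ ∑-cong (allFin m) (λ j → begin
             ∑ᶠ (λ l → below l j *ℙ term j l x) +ℙ ∑ᶠ (λ l → below j l *ℙ term j l x)
               ≡⟨ sym (∑-+ (allFin m) (λ l → below l j *ℙ term j l x) (λ l → below j l *ℙ term j l x)) ⟩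
             ∑ᶠ (λ l → below l j *ℙ term j l x +ℙ below j l *ℙ term j l x)
               ≡⟨ ∑-cong (allFin m) (λ l → begin
                    below l j *ℙ term j l x +ℙ below j l *ℙ term j l x
                      ≡⟨ solve 5 (λ a b c d e → a :* (c :* (d :* e)) :+ b :* (c :* (d :* e)) := c :* (d :* ((a :+ b) :* e)))
                           refl (below l j) (below j l) (w j x) (w l (exchange x)) (δ l j x) ⟩
                    w j x *ℙ (w l (exchange x) *ℙ ((below l j +ℙ below j l) *ℙ δ l j x))
                      ≡⟨ cong (λ d → w j x *ℙ (w l (exchange x) *ℙ d)) (halves l j x) ⟩
                    term j l x ∎) ⟩
             ∑ᶠ (λ l → term j l x)
               ≡⟨ ∑-*ˡ (allFin m) (w j x) (λ l → w l (exchange x) *ℙ δ l j x) ⟩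
             w j x *ℙ ∑ᶠ (λ l → w l (exchange x) *ℙ δ l j x)
               ≡⟨ cong (w j x *ℙ_) (sym (second-expanded j x)) ⟩
             w j x *ℙ D (mix first (p j) x) ∎) ⟩
      ∑ᶠ (λ j → w j x *ℙ D (mix first (p j) x))
        ≡⟨ sym (expanded x) ⟩
      D x ∎
    vanishes : ∀ x → asymmetry (α A′) x ≡ 0ℙ
    vanishes x = trans (interchange (α A x) (τ x) (α A (exchange x)) (τ (exchange x)))
      (trans (cong (D x +ℙ_) (asymmetry-τ x)) (ℙ.p+p≡0ℙ (D x)))

  symmetrise : ∀ {N} → CrossedState 1 N → Symmetrised (growth N)
  symmetrise {N} state = symmetrise-expanded approx p w w-multi crosses≤ expanded
    where
    open CrossedState state
    #crosses : ℕ
    #crosses = length crosses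
    cross : Fin #crosses → Crossed n k
    cross l = proj₁ (List.lookup crosses l)
    gh : Fin #crosses → Vec (G n) (2 ℕ.+ k) → Parity
    gh l x = Crossed.g (cross l) x *ℙ Crossed.h (cross l) x
    isX≡first : ∀ l i → isX (colour (Crossed.c (cross l)) i) ≡ first i
    isX≡first l 0F = refl
    isX≡first l 1F = refl
    isX≡first l (suc (suc i)) = code-injective
      (trans (ℕ.n<1⇒n≡0 (proj₁ (proj₂ (List.lookup crosses l)))) (sym (code-∅ k))) i
    f-first : ∀ l → Multilinear first (Crossed.f (cross l))
    f-first l = multilinear-cong (isX≡first l) (Crossed.f-multi (cross l))
    extraction = extract first gh (λ l → Crossed.f (cross l))
      (λ l → multilinear-cong (λ i → cong not (isX≡first l i)) (Crossed.gh-multi (cross l))) f-first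
    p = proj₁ extraction
    w = proj₁ (proj₂ extraction)
    w-multi : ∀ j → Multilinear first (w j)
    w-multi j = multilinear-span f-first (proj₁ (proj₂ (proj₂ extraction)) j)
    reordered : ∀ x → asymmetry (α approx) x ≡ ∑ᶠ (λ l → gh l x *ℙ Crossed.f (cross l) x)
    reordered x = trans (balance x) (trans (sym (∑ᶠ-lookup crosses (val x)))
      (∑-cong (allFin #crosses) (λ l → ℙ.*-comm (Crossed.f (cross l) x) (gh l x))))
    expanded : ∀ x → asymmetry (α approx) x ≡ ∑ᶠ (λ j → w j x *ℙ asymmetry (α approx) (mix first (p j) x))
    expanded x = trans (reordered x) (trans (proj₂ (proj₂ (proj₂ extraction)) x)
      (∑-cong (allFin #crosses) (λ j → cong (w j x *ℙ_) (sym (reordered (mix first (p j) x))))))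

  -- Lowering the code bound by one costs two steps, `orient` and `crossed-step`; at bound 1 both
  -- classes are empty and `symmetrise` is the last step.
  finish-crossed : ∀ a {N} → CrossedState (suc a) N → Symmetrised (iterate growth N (suc (a ℕ.* 2)))
  finish-crossed zero    state = symmetrise state
  finish-crossed (suc a) state = finish-crossed a (crossed-step (orient state))

  finish-bundled : ∀ a {N} → BundledState a N → Symmetrised (iterate growth N (a ℕ.+ suc (2 ℕ.^ k ℕ.* 2)))
  finish-bundled (suc a) state = finish-bundled a (bundled-step state)
  finish-bundled zero    state = finish-crossed (2 ℕ.^ k) record
    { approx = approx ; crosses = List.map bounded crosses
    ; crosses≤ = ℕ.≤-trans (ℕ.≤-reflexive (length-map bounded crosses)) crosses≤
    ; balance = λ x → trans (balance x) (trans (cong (_+ℙ ∑ crosses (cval x)) (none bundles x))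
                                               (sym (∑-map bounded crosses (val x)))) }
    where
    open BundledState state
    -- Codes are already below `2 ^ k`; the extra 1 matches the bound `suc a` of `finish-crossed`,
    -- whose descent ends at 1 rather than 0.
    bounded : Crossed n k → Crossed< (suc (2 ℕ.^ k))
    bounded t = t , ℕ.m<n⇒m<1+n (code<2^k (isX ∘ Crossed.c t)) , ℕ.m<n⇒m<1+n (code<2^k (isY ∘ Crossed.c t))
    none : ∀ (ts : List (Bundled< 0)) x → ∑ ts (bval x) ≡ 0ℙ
    none []             x = refl
    none ((_ , ()) ∷ _) x

  symmetrisable : ∀ {N} → Multilinear everywhere α₀ → SplitRank≤ N (asymmetry α₀) →
                  Symmetrised (iterate growth N (2 ℕ.^ k ℕ.+ suc (2 ℕ.^ k ℕ.* 2)))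
  symmetrisable {N} α₀-multi (ts , ts≤N , eq) = finish-bundled (2 ℕ.^ k) record
    { approx = approximation α₀ α₀-multi ([] , z≤n , λ x → ℙ.p+p≡0ℙ (α₀ x))
    ; bundles = List.map bounded lefts ; crosses = rights
    ; bundles≤ = ℕ.≤-trans (ℕ.≤-reflexive (length-map bounded lefts)) (ℕ.≤-trans (ℕ.m≤m+n _ _) total≤N)
    ; crosses≤ = ℕ.≤-trans (ℕ.m≤n+m _ (length lefts)) total≤N
    ; balance = λ x → trans (eq x) (trans (∑-cong ts (λ t → proj₂ (classify t) x))
        (trans (∑-separate (λ t → Bundled.value t x) (cval x))
               (cong (_+ℙ ∑ rights (cval x)) (sym (∑-map bounded lefts (bval x)))))) }
    where
    open Separation (separate (λ t → proj₁ (classify t)) ts)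
    total≤N : length lefts ℕ.+ length rights ≤ N
    total≤N = ℕ.≤-trans (ℕ.≤-reflexive lengths) ts≤N
    bounded : Bundled n k → Bundled< (2 ℕ.^ k)
    bounded t = t , code<2^k (Bundled.M t)

-- Iterated exponentials of cuts

-- `_/_` cancels common factors, so arithmetic with quotients is checked on unnormalised
-- representatives.
toℚᵘ-/ : ∀ i d-1 → toℚᵘ (i / suc d-1) ℚᵘ.≃ ℚᵘ.mkℚᵘ i d-1
toℚᵘ-/ i d-1 = ℚ.toℚᵘ-fromℚᵘ (ℚᵘ.mkℚᵘ i d-1)

fromℕ-* : ∀ a b → fromℕ (a ℕ.* b) ≡ fromℕ a ℚ.* fromℕ b
fromℕ-* a b = sym (ℚ.toℚᵘ-injective (ℚᵘ.≃-trans (ℚ.toℚᵘ-homo-* (fromℕ a) (fromℕ b))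
  (ℚᵘ.≃-trans (ℚᵘ.*-cong (toℚᵘ-/ (+ a) 0) (toℚᵘ-/ (+ b) 0))
  (ℚᵘ.≃-trans (ℚᵘ.≃-reflexive (cong (λ i → ℚᵘ.mkℚᵘ i 0) (sym (ℤ.pos-* a b))))
              (ℚᵘ.≃-sym (toℚᵘ-/ (+ (a ℕ.* b)) 0))))))

fromℕ-*-1/ : ∀ N-1 → fromℕ (suc N-1) ℚ.* (+ 1 / suc N-1) ≡ 1ℚ
fromℕ-*-1/ N-1 = ℚ.toℚᵘ-injective (ℚᵘ.≃-trans (ℚ.toℚᵘ-homo-* (fromℕ (suc N-1)) (+ 1 / suc N-1))
  (ℚᵘ.≃-trans (ℚᵘ.*-cong (toℚᵘ-/ (+ suc N-1) 0) (toℚᵘ-/ (+ 1) N-1))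
              (ℚᵘ.*≡* (trans (ℤ.*-identityʳ _) (trans (ℤ.*-identityʳ (+ suc N-1))
                 (sym (trans (ℤ.*-identityˡ _) (cong +_ (ℕ.*-identityˡ (suc N-1))))))))))

fromℕ-mono-< : ∀ {a b} → a ℕ.< b → fromℕ a < fromℕ b
fromℕ-mono-< {a} {b} a<b = ℚ.toℚᵘ-cancel-< (ℚᵘ.<-respˡ-≃ (ℚᵘ.≃-sym (toℚᵘ-/ (+ a) 0))
  (ℚᵘ.<-respʳ-≃ (ℚᵘ.≃-sym (toℚᵘ-/ (+ b) 0))
    (ℚᵘ.*<* (subst₂ ℤ._<_ (sym (ℤ.*-identityʳ (+ a))) (sym (ℤ.*-identityʳ (+ b))) (ℤ.+<+ a<b)))))

fromℕ-mono-≤ : ∀ {a b} → a ℕ.≤ b → fromℕ a ℚ.≤ fromℕ b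
fromℕ-mono-≤ {a} {b} a≤b with ℕ.m≤n⇒m<n∨m≡n a≤b
... | inj₁ a<b  = ℚ.<⇒≤ (fromℕ-mono-< a<b)
... | inj₂ refl = ℚ.≤-refl

2^ : ∀ m → fromℕ 2 ^ m ≡ fromℕ (2 ℕ.^ m)
2^ zero    = refl
2^ (suc m) = trans (cong (fromℕ 2 ℚ.*_) (2^ m)) (sym (fromℕ-* 2 (2 ℕ.^ m)))

DownClosed : LowerCut → Set
DownClosed x = ∀ {q q′} → q < q′ → q′ U.∈ x → q U.∈ x

cut-down : ∀ q → DownClosed (cut q)
cut-down q = ℚ.<-trans

exp-down : ∀ x → DownClosed (exp x)
exp-down x q<q′ (p , N-1 , p∈x , b>0 , q′<) = p , N-1 , p∈x , b>0 , ℚ.<-trans q<q′ q′<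

exp^-down : ∀ t {x} → DownClosed x → DownClosed (exp^ t x)
exp^-down zero    down = down
exp^-down (suc t) {x} down = exp^-down t (exp-down x)

-- With `p` and `N` both equal to `m`, the base `1 + p/N` is 2 and the approximant is `2 ^ m`.
exp-≥2^ : ∀ x m {m′} → 0 ℕ.< m → fromℕ m U.∈ x → m′ ℕ.< 2 ℕ.^ m → fromℕ m′ U.∈ exp x
exp-≥2^ x (suc m) {m′} _ m∈x m′< = fromℕ (suc m) , m , m∈x ,
  subst (0ℚ <_) (sym b≡2) (fromℕ-mono-< {0} {2} (s≤s z≤n)) ,
  subst (fromℕ m′ <_) (sym (trans (cong (_^ suc m) b≡2) (2^ (suc m)))) (fromℕ-mono-< m′<)
  where
  b≡2 : 1ℚ ℚ.+ fromℕ (suc m) ℚ.* (+ 1 / suc m) ≡ fromℕ 2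
  b≡2 = cong (1ℚ ℚ.+_) (fromℕ-*-1/ m)

-- At 5 this is 18 < 32; from there each increment adds 3 on the left and doubles the right.
m+m+m+3<2^m : ∀ {m} → 5 ℕ.≤ m → m ℕ.+ (m ℕ.+ (m ℕ.+ 3)) ℕ.< 2 ℕ.^ m
m+m+m+3<2^m {m} 5≤m with ℕ.m≤n⇒∃[o]m+o≡n 5≤m
... | j , refl = go j
  where
  shift : ∀ m → suc (suc m ℕ.+ (suc m ℕ.+ (suc m ℕ.+ 3))) ≡ suc (m ℕ.+ (m ℕ.+ (m ℕ.+ 3))) ℕ.+ 3
  shift = solve-∀
  step : ∀ m → 3 ℕ.≤ m → m ℕ.+ (m ℕ.+ (m ℕ.+ 3)) ℕ.< 2 ℕ.^ m → suc m ℕ.+ (suc m ℕ.+ (suc m ℕ.+ 3)) ℕ.< 2 ℕ.^ suc m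
  step m 3≤m lt = ℕ.≤-trans (ℕ.≤-reflexive (shift m)) (ℕ.+-mono-≤ lt
    (ℕ.≤-trans (ℕ.≤-trans 3≤m (ℕ.<⇒≤ (ℕ.≤-<-trans (ℕ.m≤m+n m (m ℕ.+ (m ℕ.+ 3))) lt)))
               (ℕ.m≤m+n (2 ℕ.^ m) 0)))
  go : ∀ j → (5 ℕ.+ j) ℕ.+ ((5 ℕ.+ j) ℕ.+ ((5 ℕ.+ j) ℕ.+ 3)) ℕ.< 2 ℕ.^ (5 ℕ.+ j)
  go zero    = toWitness {a? = 18 ℕ.<? 32} _
  go (suc j) = step (5 ℕ.+ j) (s≤s (s≤s (s≤s z≤n))) (go j)

growth-mono : ∀ {a b} → a ℕ.≤ b → growth a ℕ.≤ growth b
growth-mono le = ℕ.+-mono-≤ (ℕ.+-mono-≤ le le) (ℕ.*-mono-≤ le (ℕ.*-mono-≤ le (ℕ.+-mono-≤ le le)))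

growth<8e³ : ∀ e′ → let e = suc e′ in growth e ℕ.< e ℕ.* (e ℕ.* (e ℕ.* 8))
growth<8e³ e′ = ℕ.≤-trans (ℕ.m≤m+n _ _) (ℕ.≤-reflexive (expand e′))
  where
  -- With `e = d + 1`, the difference of `8e³` and `2e + 2e³ + 1` is `3 + 16d + 18d² + 6d³`, here in
  -- Horner form.
  expand : ∀ d →
           suc (suc d ℕ.+ suc d ℕ.+ suc d ℕ.* (suc d ℕ.* (suc d ℕ.+ suc d))) ℕ.+ (3 ℕ.+ d ℕ.* (16 ℕ.+ d ℕ.* (18 ℕ.+ d ℕ.* 6)))
             ≡ suc d ℕ.* (suc d ℕ.* (suc d ℕ.* 8))
  expand = solve-∀

n<2^n : ∀ n → n ℕ.< 2 ℕ.^ n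
n<2^n zero    = s≤s z≤n
n<2^n (suc n) = ℕ.+-mono-≤ (ℕ.m^n>0 2 n) (ℕ.≤-trans (n<2^n n) (ℕ.m≤m+n (2 ℕ.^ n) 0))

-- The right side is `8e³` for `e = 2 ^ m`, which exceeds `growth e`, and `growth` is monotone with
-- `m < e`.
growth<2^ : ∀ m → growth m ℕ.< 2 ℕ.^ (m ℕ.+ (m ℕ.+ (m ℕ.+ 3)))
growth<2^ m = subst (growth m ℕ.<_) (sym power) (ℕ.≤-<-trans (growth-mono (ℕ.<⇒≤ (n<2^n m))) (go (2 ℕ.^ m) (ℕ.m^n>0 2 m)))
  where
  power : 2 ℕ.^ (m ℕ.+ (m ℕ.+ (m ℕ.+ 3))) ≡ 2 ℕ.^ m ℕ.* (2 ℕ.^ m ℕ.* (2 ℕ.^ m ℕ.* 8))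
  power = trans (ℕ.^-distribˡ-+-* 2 m _) (cong (2 ℕ.^ m ℕ.*_)
    (trans (ℕ.^-distribˡ-+-* 2 m _) (cong (2 ℕ.^ m ℕ.*_) (ℕ.^-distribˡ-+-* 2 m 3))))
  go : ∀ e → 0 ℕ.< e → growth e ℕ.< e ℕ.* (e ℕ.* (e ℕ.* 8))
  go (suc e′) _ = growth<8e³ e′

-- The first exponential reaches the exponent `3m + 3`, the second reaches 2 to that power.
exp-growth : ∀ {x} m → 5 ℕ.≤ m → fromℕ m U.∈ x → fromℕ (growth m) U.∈ exp (exp x)
exp-growth {x} m 5≤m m∈x = exp-≥2^ (exp x) (m ℕ.+ (m ℕ.+ (m ℕ.+ 3))) (ℕ.≤-trans 0<m (ℕ.m≤m+n m _))
  (exp-≥2^ x m 0<m m∈x (m+m+m+3<2^m 5≤m)) (growth<2^ m)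
  where
  0<m : 0 ℕ.< m
  0<m = ℕ.≤-trans (s≤s z≤n) 5≤m

exp^-growth : ∀ s {x m} → 5 ℕ.≤ m → fromℕ m U.∈ x → fromℕ (iterate growth m s) U.∈ exp^ (s ℕ.* 2) x
exp^-growth zero    5≤m m∈x = m∈x
exp^-growth (suc s) {x} {m} 5≤m m∈x =
  exp^-growth s (ℕ.≤-trans 5≤m (N≤growth m)) (exp-growth m 5≤m m∈x)

-- For the case `r = 0`, where the starting cut contains no natural number. The approximant with
-- `p = -1/2` and `N = 1` is `1/2`, so every negative rational lies below the exponential.
exp^-0 : ∀ t {x} → cut 0ℚ ⊆ x → cut 0ℚ ⊆ exp^ t x
exp^-0 zero    sub = sub
exp^-0 (suc t) {x} sub = exp^-0 t λ q<0 → -½ , 0 , sub (from-yes (-½ ℚ.<? 0ℚ)) ,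
    from-yes (0ℚ ℚ.<? base) , ℚ.<-trans q<0 (from-yes (0ℚ ℚ.<? base ^ 1))
  where
  -½ base : ℚ
  -½ = ℤ.-[1+ 0 ] / 2
  base = 1ℚ ℚ.+ -½ ℚ.* (+ 1 / 1)

iterate-growth-0 : ∀ s → iterate growth 0 s ≡ 0
iterate-growth-0 zero    = refl
iterate-growth-0 (suc s) = iterate-growth-0 s

-- For `r ≥ 1` the factor 5 meets the threshold of `exp-growth`. Cuts are open, so `5r` belongs to a
-- cut only at a strictly larger number, which is why the constant is 6.
tower-bound : ∀ s r {p} → p ℕ.≤ iterate growth (5 ℕ.* r) s →
              cut (fromℕ p) ⊆ exp^ (s ℕ.* 2) (cut (fromℕ 6 ℚ.* fromℕ r))
tower-bound s zero p≤ q<p = exp^-0 (s ℕ.* 2) (λ q<0 → q<0)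
  (ℚ.<-≤-trans q<p (fromℕ-mono-≤ (ℕ.≤-trans p≤ (ℕ.≤-reflexive (iterate-growth-0 s)))))
tower-bound s r@(suc r-1) p≤ q<p = exp^-down (s ℕ.* 2) (cut-down _) (ℚ.<-≤-trans q<p (fromℕ-mono-≤ p≤))
  (exp^-growth s (ℕ.m≤m*n 5 r) (subst (fromℕ (5 ℕ.* r) <_) (fromℕ-* 6 r)
    (fromℕ-mono-< {5 ℕ.* r} {6 ℕ.* r} (ℕ.m<n+m (5 ℕ.* r) {r} (s≤s z≤n)))))

-- The first two variables

permute-transpose : ∀ (x : Vec A (2 ℕ.+ k)) → permute (transpose 0F 1F) x ≡ exchange x
permute-transpose (x ∷ y ∷ z) = cong (λ v → y ∷ x ∷ v) (tabulate∘lookup z)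

module _ {k} (π : Permutation′ (2 ℕ.+ k)) (fixes : ∀ i → i ∉ ⁅ 0F ⁆ ∪ ⁅ 1F ⁆ → π ⟨$⟩ʳ i ≡ i) where

  fixes-tailʳ : ∀ i → π ⟨$⟩ʳ suc (suc i) ≡ suc (suc i)
  fixes-tailʳ i = fixes (suc (suc i)) λ { (there (there i∈)) → [ ∉⊥ , ∉⊥ ]′ (x∈p∪q⁻ _ _ i∈) }

  fixes-tailˡ : ∀ i → π ⟨$⟩ˡ suc (suc i) ≡ suc (suc i)
  fixes-tailˡ i = trans (cong (π ⟨$⟩ˡ_) (sym (fixes-tailʳ i))) (inverseˡ π)

  injectiveˡ : ∀ {i j} → π ⟨$⟩ˡ i ≡ π ⟨$⟩ˡ j → i ≡ j
  injectiveˡ eq = trans (sym (inverseʳ π)) (trans (cong (π ⟨$⟩ʳ_) eq) (inverseʳ π))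

  -- The inverse of `π` fixes every later index, so by injectivity it maps the first two indices
  -- among themselves, either identically or by swapping them.
  permute-pair : (∀ (x : Vec A (2 ℕ.+ k)) → permute π x ≡ x) ⊎
                 (∀ (x : Vec A (2 ℕ.+ k)) → permute π x ≡ exchange x)
  permute-pair = go (π ⟨$⟩ˡ 0F) (π ⟨$⟩ˡ 1F) refl refl
    where
    go : ∀ i j → π ⟨$⟩ˡ 0F ≡ i → π ⟨$⟩ˡ 1F ≡ j →
         (∀ (x : Vec A (2 ℕ.+ k)) → permute π x ≡ x) ⊎
         (∀ (x : Vec A (2 ℕ.+ k)) → permute π x ≡ exchange x)
    go (suc (suc i)) _ eq₀ _ = contradiction (injectiveˡ (trans eq₀ (sym (fixes-tailˡ i)))) λ ()
    go _ (suc (suc i)) _ eq₁ = contradiction (injectiveˡ (trans eq₁ (sym (fixes-tailˡ i)))) λ ()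
    go 0F 0F eq₀ eq₁ = contradiction (injectiveˡ (trans eq₀ (sym eq₁))) λ ()
    go 1F 1F eq₀ eq₁ = contradiction (injectiveˡ (trans eq₀ (sym eq₁))) λ ()
    go 0F 1F eq₀ eq₁ = inj₁ λ x → trans (tabulate-cong (λ i → cong (lookup x) (pointwise i))) (tabulate∘lookup x)
      where
      pointwise : ∀ i → π ⟨$⟩ˡ i ≡ i
      pointwise 0F            = eq₀
      pointwise 1F            = eq₁
      pointwise (suc (suc i)) = fixes-tailˡ i
    go 1F 0F eq₀ eq₁ = inj₂ λ x → trans (tabulate-cong (pointwise x)) (tabulate∘lookup (exchange x))
      where
      pointwise : ∀ x i → lookup x (π ⟨$⟩ˡ i) ≡ lookup (exchange x) i
      pointwise x@(_ ∷ _ ∷ _) 0F            = cong (lookup x) eq₀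
      pointwise x@(_ ∷ _ ∷ _) 1F            = cong (lookup x) eq₁
      pointwise x@(_ ∷ _ ∷ _) (suc (suc i)) = cong (lookup x) (fixes-tailˡ i)

theorem7 : (k : ℕ) (k≥2 : k ≥ 2) →
    let i₁ = inject≤ 0F k≥2
        i₂ = inject≤ 1F k≥2
    in
    Σ[ A ∈ ℚ ] Σ[ t ∈ ℕ ] (0ℚ < A ×
      ((n r : ℕ) (α : MultilinearForm n k) →
        (∃[ p ] (IsPrank (α ⊕ α ∘ᶠ transpose i₁ i₂) p × p ≤ r)) →
        Σ[ α′ ∈ MultilinearForm n k ]
          (SymmetricIn (⁅ i₁ ⁆ ∪ ⁅ i₂ ⁆) α′ ×
           (∃[ p′ ] (IsPrank (α ⊕ α′) p′ ×
                     cut (fromℕ p′) ⊆ exp^ t (cut (A * fromℕ r)))))))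
theorem7 (suc (suc k)) (s≤s (s≤s z≤n)) =
  fromℕ 6 , s ℕ.* 2 , fromℕ-mono-< {0} {6} (s≤s z≤n) , main
  where
  s : ℕ
  s = 2 ℕ.^ k ℕ.+ suc (2 ℕ.^ k ℕ.* 2)
  main : (n r : ℕ) (α : MultilinearForm n (2 ℕ.+ k)) →
         (∃[ p ] (IsPrank (α ⊕ α ∘ᶠ transpose 0F 1F) p × p ≤ r)) →
         Σ[ α′ ∈ MultilinearForm n (2 ℕ.+ k) ]
           (SymmetricIn (⁅ 0F ⁆ ∪ ⁅ 1F ⁆) α′ ×
            (∃[ p′ ] (IsPrank (α ⊕ α′) p′ ×
                      cut (fromℕ p′) ⊆ exp^ (s ℕ.* 2) (cut (fromℕ 6 * fromℕ r)))))
  main n r α (p , (decomposition , _) , p≤r) = α′ , symmetric , p′ , prank , λ {q} → tower-bound s r p′≤ {q}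
    where
    open Reduction ⟦ α ⟧ using (module Approximation)
    -- The available bound is `r`; it is relaxed to `5 * r` to provide the starting value of
    -- `tower-bound`.
    asymmetry-rank : SplitRank≤ (5 ℕ.* r) (asymmetry ⟦ α ⟧)
    asymmetry-rank = let ts , len , eq = fromDecomposition (α ⊕ α ∘ᶠ transpose 0F 1F) decomposition in
      ts , ℕ.≤-trans (ℕ.≤-trans (ℕ.≤-reflexive len) p≤r) (ℕ.m≤m+n r _) ,
      λ x → trans (cong (λ y → ⟦ α ⟧ x +ℙ ⟦ α ⟧ y) (sym (permute-transpose x))) (eq x)
    symmetrised = Conclusion.symmetrisable ⟦ α ⟧ (multilinear α) asymmetry-rank
    open Approximation (proj₁ symmetrised) renaming (α to ω)
    α′ : MultilinearForm n (2 ℕ.+ k)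
    α′ = toForm ω α-multi
    exchange-invariant : ∀ x → ω (exchange x) ≡ ω x
    exchange-invariant x = trans (cong (_+ℙ ω (exchange x)) (sym (ℙ.p+p≡0ℙ (ω x))))
      (trans (ℙ.+-assoc (ω x) (ω x) (ω (exchange x)))
             (trans (cong (ω x +ℙ_) (proj₂ symmetrised x)) (ℙ.+-identityʳ (ω x))))
    symmetric : SymmetricIn (⁅ 0F ⁆ ∪ ⁅ 1F ⁆) α′
    symmetric π fixes x with permute-pair π fixes
    ... | inj₁ same      = cong ω (same x)
    ... | inj₂ exchanged = trans (cong ω (exchanged x)) (exchange-invariant x)
    ranked = let ts , len , eq = near in
      ∃-prank (α ⊕ α′) (toDecomposition (α ⊕ α′) ts eq)
    p′ : ℕ
    p′ = proj₁ ranked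
    prank : IsPrank (α ⊕ α′) p′
    prank = proj₁ (proj₂ ranked)
    p′≤ : p′ ≤ iterate growth (5 ℕ.* r) s
    p′≤ = ℕ.≤-trans (proj₂ (proj₂ ranked)) (proj₁ (proj₂ near))
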